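{- For every integer $n\geq 3$, writing $f_q(n)$ for the total number of occurrences of the pattern $q$ in all permutations of $S_n(123,132)$, we have $$f_{213}(n)=(n-3)2^{n-2}+1,$$ $$f_{231}(n)=f_{312}(n)=(n^2-5n+8)2^{n-3}-1,$$ $$f_{321}(n)=\left(\frac{n^3}{3}-2n^2+\frac{14n}{3}-5\right)2^{n-2}+1.$$
   Context: $S_n$ is the set of permutations of $\{1,\dots,n\}$ written in one-line notation $\sigma=\sigma_1\sigma_2\cdots\sigma_n$. For $q\in S_k$, an occurrence of the pattern $q$ in $\sigma\in S_n$ is a choice of indices $i_1<i_2<\cdots<i_k$ in $\{1,\dots,n\}$ such that for all $1\le j,l\le k$, $q_j<q_l$ if and only if $\sigma_{i_j}<\sigma_{i_l}$. Let $f_q(\sigma)$ be the number of occurrences of $q$ in $\sigma$; $\sigma$ avoids $q$ if $f_q(\sigma)=0$. $S_n(123,132)$ is the set of permutations in $S_n$ avoiding both $123$ and $132$, and $f_q(n)=\sum_{\sigma\in S_n(123,132)}f_q(\sigma)$. -}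

module Defs where

open import Data.Fin using (Fin; _<_)
open import Data.Fin.Patterns using (0F; 1F; 2F)
open import Data.Fin.Properties using (_≟_; _<?_; any?; all?)
open import Data.Integer using (+_)
open import Data.List using (List; []; _∷_; allFin; cartesianProductWith; filter; length; map)
open import Data.Nat as ℕ using (ℕ; zero; suc)
open import Data.Nat.ListAction using (sum)
open import Data.Product using (_×_; _,_)
open import Data.Rational using (ℚ; _/_)
open import Data.Vec as Vec using (Vec; lookup; _∷_; [])
open import Function.Bundles using (_⇔_; mk⇔; module Equivalence)
open import Function.Definitions using (Injective; Surjective; Bijective; StrictlySurjective)
open import Function.Consequences.Propositional
  using (strictlySurjective⇒surjective; surjective⇒strictlySurjective)
open import Relation.Binary.PropositionalEquality using (_≡_)
open import Relation.Nullary using (Dec)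
open import Relation.Nullary.Decidable using (map′; _×-dec_; _→-dec_)

-- Positions and values are numbered from 0: Fin n stands for {1,…,n}, and only
-- the order of the values matters below.  A word w : Vec (Fin n) k is read as
-- w₁w₂⋯w_k.

words : ∀ k n → List (Vec (Fin n) k)
words zero    n = [] ∷ []
words (suc k) n = cartesianProductWith _∷_ (allFin n) (words k n)

IsPermutation : ∀ {n} → Vec (Fin n) n → Set
IsPermutation σ = Bijective _≡_ _≡_ (lookup σ)

StrictlyIncreasing : ∀ {k n} → Vec (Fin n) k → Set
StrictlyIncreasing i = ∀ j l → j < l → lookup i j < lookup i l

IsOccurrence : ∀ {k n} → Vec (Fin k) k → Vec (Fin n) n → Vec (Fin n) k → Set
IsOccurrence q σ i =
  StrictlyIncreasing i ×
  (∀ j l → lookup q j < lookup q l ⇔ lookup σ (lookup i j) < lookup σ (lookup i l))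

_⇔-dec_ : ∀ {A B : Set} → Dec A → Dec B → Dec (A ⇔ B)
a? ⇔-dec b? =
  map′ (λ (f , g) → mk⇔ f g) (λ e → Equivalence.to e , Equivalence.from e)
    ((a? →-dec b?) ×-dec (b? →-dec a?))

isPermutation? : ∀ {n} (σ : Vec (Fin n) n) → Dec (IsPermutation σ)
isPermutation? {n} σ = injective? ×-dec surjective?
  where
  f : Fin n → Fin n
  f = lookup σ

  injective? : Dec (Injective _≡_ _≡_ f)
  injective? =
    map′ (λ h {x} {y} → h x y) (λ h x y → h {x} {y})
      (all? λ x → all? λ y → (f x ≟ f y) →-dec (x ≟ y))

  surjective? : Dec (Surjective _≡_ _≡_ f)
  surjective? =
    map′ strictlySurjective⇒surjective surjective⇒strictlySurjective
      (all? λ y → any? λ x → f x ≟ y)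

isOccurrence? : ∀ {k n} (q : Vec (Fin k) k) (σ : Vec (Fin n) n) (i : Vec (Fin n) k) →
                Dec (IsOccurrence q σ i)
isOccurrence? q σ i =
  (all? λ j → all? λ l → (j <? l) →-dec (lookup i j <? lookup i l))
  ×-dec
  (all? λ j → all? λ l →
    (lookup q j <? lookup q l) ⇔-dec (lookup σ (lookup i j) <? lookup σ (lookup i l)))

occurrences : ∀ {k n} → Vec (Fin k) k → Vec (Fin n) n → ℕ
occurrences {k} {n} q σ = length (filter (isOccurrence? q σ) (words k n))

Avoids : ∀ {k n} → Vec (Fin k) k → Vec (Fin n) n → Set
Avoids q σ = occurrences q σ ≡ 0

avoids? : ∀ {k n} (q : Vec (Fin k) k) (σ : Vec (Fin n) n) → Dec (Avoids q σ)
avoids? q σ = occurrences q σ ℕ.≟ 0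

p123 p132 p213 p231 p312 p321 : Vec (Fin 3) 3
p123 = 0F ∷ 1F ∷ 2F ∷ []
p132 = 0F ∷ 2F ∷ 1F ∷ []
p213 = 1F ∷ 0F ∷ 2F ∷ []
p231 = 1F ∷ 2F ∷ 0F ∷ []
p312 = 2F ∷ 0F ∷ 1F ∷ []
p321 = 2F ∷ 1F ∷ 0F ∷ []

S : ∀ n → List (Vec (Fin n) n)
S n = filter isPermutation? (words n n)

S[123,132] : ∀ n → List (Vec (Fin n) n)
S[123,132] n = filter (λ σ → avoids? p123 σ ×-dec avoids? p132 σ) (S n)

total : ∀ {k} → Vec (Fin k) k → ℕ → ℕ
total q n = sum (map (occurrences q) (S[123,132] n))

toℚ : ℕ → ℚ
toℚ m = + m / 1

{-# OPTIONS --safe #-}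
module Submission where

-- In a permutation avoiding 123 and 132 every letter has at most one larger letter
-- to its right, so the first letter is the largest or the second largest one and
-- the rest is, up to order isomorphism, an arbitrary shorter avoider.  Hence avoiders
-- of length m + 1 correspond to binary words of length m.  The occurrences of a
-- pattern that start at the first letter are pairs of later letters, classified by
-- their relative order and by whether one of them is the maximum of the rest; the
-- resulting statistics of binary words satisfy linear recurrences.

open import Defs
open import Data.Bool using (Bool; true; false; if_then_else_)
open import Data.Empty using (⊥)
open import Data.Fin using (Fin; zero; suc; toℕ; _<_; _≤_; fromℕ; inject₁; punchIn; punchOut)
open import Data.Fin.Patterns using (0F; 1F; 2F)
open import Data.Fin.Properties as Fin using (_≟_; _<?_; all?)
open import Data.Integer as ℤ using (+_)
import Data.Integer.Properties as ℤ
open import Data.List using (List; []; _∷_; _++_; filter; length; map; allFin; tabulate; cartesianProductWith)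
open import Data.List.Membership.Propositional using (_∈_)
open import Data.List.Membership.Propositional.Properties
  using (∈-cartesianProductWith⁺; ∈-allFin; ∈-filter⁺; ∈-filter⁻; ∈-map⁺; ∈-map⁻; ∈-length)
open import Data.List.Membership.Propositional.Properties.WithK using (unique∧set⇒bag)
open import Data.List.Properties as List using (map-tabulate; map-++)
open import Data.List.Relation.Binary.BagAndSetEquality using (∼bag⇒↭)
open import Data.List.Relation.Binary.Permutation.Propositional using (_↭_)
open import Data.List.Relation.Binary.Permutation.Propositional.Properties using (map⁺)
open import Data.List.Relation.Unary.All using ([]; _∷_)
open import Data.List.Relation.Unary.AllPairs using ([]; _∷_)
open import Data.List.Relation.Unary.Any using (here; there)
open import Data.List.Relation.Unary.Unique.Propositional using (Unique)
import Data.List.Relation.Unary.Unique.Propositional.Properties as Unique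
open import Data.Nat as ℕ using (ℕ; zero; suc; _≥_; _∸_; _^_)
open import Data.Nat.ListAction using (sum)
open import Data.Nat.ListAction.Properties using (sum-++; sum-↭)
import Data.Nat.Properties as ℕ
open import Algebra.Properties.CommutativeMonoid.Sum ℕ.+-0-commutativeMonoid
  using (sum-cong-≗) renaming (sum to ∑)
open import Data.Nat.Tactic.RingSolver using (solve-∀)
open import Data.Product using (_×_; _,_; proj₁; proj₂; ∃)
open import Data.Rational using (ℚ; toℚᵘ; _+_; _-_; _*_; _/_; 1ℚ)
import Data.Rational.Properties as ℚ
open import Data.Rational.Solver using (module +-*-Solver)
import Data.Rational.Unnormalised as ℚᵘ
import Data.Rational.Unnormalised.Properties as ℚᵘ
open import Data.Vec as Vec using (Vec; []; _∷_; lookup)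
open import Data.Vec.Properties as Vec using (lookup-map)
open import Function using (_∘_; id; _⇔_; mk⇔; module Equivalence)
open import Function.Consequences.Propositional
  using (strictlySurjective⇒surjective; surjective⇒strictlySurjective)
open import Function.Construct.Composition using (_⇔-∘_)
open import Function.Construct.Symmetry using (⇔-sym)
open import Function.Definitions using (StrictlySurjective)
open import Relation.Binary using (Tri; tri<; tri≈; tri>)
open import Relation.Binary.PropositionalEquality
import Relation.Binary.Reasoning.Setoid as ≈-Reasoning
open import Relation.Nullary using (Dec; yes; no; does; ¬_; contradiction)
open import Relation.Nullary.Decidable using (_×-dec_)

-- The maximum of the rest is singled out because it is the only later letter that can exceed the
-- first one: a pair containing a larger letter completes 213 or 231, and a pair below the first
-- letter completes 312 or 321. The obstacle is that `occurrences` filters a list of position words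
-- and so has no recursion along the permutation. `tripleSum` supplies one, since the terms of the
-- first letter split off from it. The weight of a triple is kept abstract there, with one unknown
-- constant for each of the four remaining patterns: a single evaluation then gives all four counts
-- and also shows that decoded words avoid 123 and 132. The closed forms are proved in ℕ, with a
-- negative 1 moved to the other side and a factor 3 clearing the denominators of the cubic; only
-- the final formulas live in ℚ.

-- Indicators and finite sums

indicator : ∀ {P : Set} → Dec P → ℕ
indicator P? = if does P? then 1 else 0

indicator-yes : ∀ {P : Set} (P? : Dec P) → P → indicator P? ≡ 1
indicator-yes (yes _) _ = refl
indicator-yes (no ¬p) p = contradiction p ¬p

indicator-no : ∀ {P : Set} (P? : Dec P) → ¬ P → indicator P? ≡ 0
indicator-no (no _)  _  = refl
indicator-no (yes p) ¬p = contradiction p ¬p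

indicator-⇔ : ∀ {P Q : Set} (P? : Dec P) (Q? : Dec Q) → P ⇔ Q → indicator P? ≡ indicator Q?
indicator-⇔ P? (yes q) e = indicator-yes P? (Equivalence.from e q)
indicator-⇔ P? (no ¬q) e = indicator-no P? (¬q ∘ Equivalence.to e)

length-filter : ∀ {A : Set} {P : A → Set} (P? : ∀ x → Dec (P x)) xs →
                length (filter P? xs) ≡ sum (map (indicator ∘ P?) xs)
length-filter P? []       = refl
length-filter P? (x ∷ xs) with does (P? x)
... | true  = cong suc (length-filter P? xs)
... | false = length-filter P? xs

∑-zero : ∀ {n} {f : Fin n → ℕ} → (∀ i → f i ≡ 0) → ∑ f ≡ 0
∑-zero {zero}  f≡0 = refl
∑-zero {suc n} f≡0 = cong₂ ℕ._+_ (f≡0 zero) (∑-zero (f≡0 ∘ suc))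

sum-tabulate : ∀ {n} (f : Fin n → ℕ) → sum (tabulate f) ≡ ∑ f
sum-tabulate {zero}  f = refl
sum-tabulate {suc n} f = cong (f zero ℕ.+_) (sum-tabulate (f ∘ suc))

sum-allFin : ∀ {n} (f : Fin n → ℕ) → sum (map f (allFin n)) ≡ ∑ f
sum-allFin f = trans (cong sum (map-tabulate id f)) (sum-tabulate f)

sum-map-++ : ∀ {A : Set} (f : A → ℕ) xs ys →
             sum (map f (xs ++ ys)) ≡ sum (map f xs) ℕ.+ sum (map f ys)
sum-map-++ f xs ys = trans (cong sum (map-++ f xs ys)) (sum-++ (map f xs) (map f ys))

sum-cartesianProductWith : ∀ {A B C : Set} (g : A → B → C) (f : C → ℕ) xs ys →
  sum (map f (cartesianProductWith g xs ys)) ≡ sum (map (λ x → sum (map (f ∘ g x) ys)) xs)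
sum-cartesianProductWith g f []       ys = refl
sum-cartesianProductWith g f (x ∷ xs) ys =
  trans (sum-map-++ f (map (g x) ys) _)
        (cong₂ ℕ._+_ (cong sum (sym (List.map-∘ ys))) (sum-cartesianProductWith g f xs ys))

sum-words : ∀ k n (f : Vec (Fin n) (suc k) → ℕ) →
            sum (map f (words (suc k) n)) ≡ ∑ (λ i → sum (map (f ∘ (i ∷_)) (words k n)))
sum-words k n f = trans (sum-cartesianProductWith _∷_ f (allFin n) (words k n)) (sum-allFin {n} _)

-- Sums over pairs and triples of letters in order of position

vecSum : ∀ {A : Set} {n} → (A → ℕ) → Vec A n → ℕ
vecSum h []      = 0
vecSum h (x ∷ v) = h x ℕ.+ vecSum h v

pairSum : ∀ {A : Set} {n} → (A → A → ℕ) → Vec A n → ℕ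
pairSum h []      = 0
pairSum h (x ∷ v) = vecSum (h x) v ℕ.+ pairSum h v

tripleSum : ∀ {A : Set} {n} → (A → A → A → ℕ) → Vec A n → ℕ
tripleSum h []      = 0
tripleSum h (x ∷ v) = pairSum (h x) v ℕ.+ tripleSum h v

vecSum-map : ∀ {A B : Set} {n} (h : B → ℕ) (f : A → B) (v : Vec A n) →
             vecSum h (Vec.map f v) ≡ vecSum (h ∘ f) v
vecSum-map h f []      = refl
vecSum-map h f (x ∷ v) = cong (h (f x) ℕ.+_) (vecSum-map h f v)

pairSum-map : ∀ {A B : Set} {n} (h : B → B → ℕ) (f : A → B) (v : Vec A n) →
              pairSum h (Vec.map f v) ≡ pairSum (λ x y → h (f x) (f y)) v
pairSum-map h f []      = refl
pairSum-map h f (x ∷ v) = cong₂ ℕ._+_ (vecSum-map (h (f x)) f v) (pairSum-map h f v)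

tripleSum-map : ∀ {A B : Set} {n} (h : B → B → B → ℕ) (f : A → B) (v : Vec A n) →
                tripleSum h (Vec.map f v) ≡ tripleSum (λ x y z → h (f x) (f y) (f z)) v
tripleSum-map h f []      = refl
tripleSum-map h f (x ∷ v) = cong₂ ℕ._+_ (pairSum-map (h (f x)) f v) (tripleSum-map h f v)

vecSum-cong : ∀ {A : Set} {n} {h k : A → ℕ} → (∀ x → h x ≡ k x) → (v : Vec A n) →
              vecSum h v ≡ vecSum k v
vecSum-cong h≡k []      = refl
vecSum-cong h≡k (x ∷ v) = cong₂ ℕ._+_ (h≡k x) (vecSum-cong h≡k v)

pairSum-cong : ∀ {A : Set} {n} {h k : A → A → ℕ} → (∀ x y → h x y ≡ k x y) → (v : Vec A n) →
               pairSum h v ≡ pairSum k v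
pairSum-cong h≡k []      = refl
pairSum-cong h≡k (x ∷ v) = cong₂ ℕ._+_ (vecSum-cong (h≡k x) v) (pairSum-cong h≡k v)

tripleSum-cong : ∀ {A : Set} {n} {h k : A → A → A → ℕ} → (∀ x y z → h x y z ≡ k x y z) →
                 (v : Vec A n) → tripleSum h v ≡ tripleSum k v
tripleSum-cong h≡k []      = refl
tripleSum-cong h≡k (x ∷ v) = cong₂ ℕ._+_ (pairSum-cong (h≡k x) v) (tripleSum-cong h≡k v)

∑-lookup : ∀ {A : Set} {n} (h : A → ℕ) (v : Vec A n) → ∑ (λ i → h (lookup v i)) ≡ vecSum h v
∑-lookup h []      = refl
∑-lookup h (x ∷ v) = cong (h x ℕ.+_) (∑-lookup h v)

-- The diagonal and everything below it vanish, so each row keeps only its entries to the right of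
-- the diagonal. `F` takes indices because the count of an occurrence depends on the letters alone
-- only once the positions are known to increase.
∑-pairs : ∀ {A : Set} {n} (h : A → A → ℕ) (v : Vec A n) (F : Fin n → Fin n → ℕ) →
          (∀ i j → i < j → F i j ≡ h (lookup v i) (lookup v j)) →
          (∀ i j → ¬ i < j → F i j ≡ 0) →
          ∑ (λ i → ∑ (F i)) ≡ pairSum h v
∑-pairs h []      F _    _    = refl
∑-pairs h (x ∷ v) F incr ¬incr = cong₂ ℕ._+_
  (cong₂ ℕ._+_ (¬incr 0F 0F λ ())
    (trans (sum-cong-≗ (λ j → incr 0F (suc j) ℕ.z<s)) (∑-lookup (h x) v)))
  (trans (sum-cong-≗ (λ i → cong (ℕ._+ ∑ (F (suc i) ∘ suc)) (¬incr (suc i) 0F λ ())))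
    (∑-pairs h v (λ i j → F (suc i) (suc j))
      (λ i j i<j → incr (suc i) (suc j) (ℕ.s<s i<j))
      (λ i j i≮j → ¬incr (suc i) (suc j) (i≮j ∘ ℕ.s<s⁻¹))))

∑-triples : ∀ {A : Set} {n} (h : A → A → A → ℕ) (v : Vec A n) (F : Fin n → Fin n → Fin n → ℕ) →
            (∀ i j l → i < j → j < l → F i j l ≡ h (lookup v i) (lookup v j) (lookup v l)) →
            (∀ i j l → ¬ (i < j × j < l) → F i j l ≡ 0) →
            ∑ (λ i → ∑ (λ j → ∑ (F i j))) ≡ tripleSum h v
∑-triples h []      F _    _     = refl
∑-triples h (x ∷ v) F incr ¬incr = cong₂ ℕ._+_
  (cong₂ ℕ._+_ (∑-zero (λ l → ¬incr 0F 0F l λ ()))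
    (trans (sum-cong-≗ (λ j → cong (ℕ._+ ∑ (F 0F (suc j) ∘ suc)) (¬incr 0F (suc j) 0F λ ())))
      (∑-pairs (h x) v (λ j l → F 0F (suc j) (suc l))
        (λ j l j<l → incr 0F (suc j) (suc l) ℕ.z<s (ℕ.s<s j<l))
        (λ j l j≮l → ¬incr 0F (suc j) (suc l) (j≮l ∘ ℕ.s<s⁻¹ ∘ proj₂)))))
  (trans (sum-cong-≗ (λ i → cong₂ ℕ._+_ (∑-zero (λ l → ¬incr (suc i) 0F l λ ()))
      (sum-cong-≗ (λ j → cong (ℕ._+ ∑ (F (suc i) (suc j) ∘ suc)) (¬incr (suc i) (suc j) 0F λ ())))))
    (∑-triples h v (λ i j l → F (suc i) (suc j) (suc l))
      (λ i j l i<j j<l → incr (suc i) (suc j) (suc l) (ℕ.s<s i<j) (ℕ.s<s j<l))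
      (λ i j l ¬i<j<l → ¬incr (suc i) (suc j) (suc l)
        (λ (i<j , j<l) → ¬i<j<l (ℕ.s<s⁻¹ i<j , ℕ.s<s⁻¹ j<l)))))

-- Order isomorphism and pattern occurrences

OrderIso : ∀ {k m n} → Vec (Fin m) k → Vec (Fin n) k → Set
OrderIso q w = ∀ j l → lookup q j < lookup q l ⇔ lookup w j < lookup w l

orderIso? : ∀ {k m n} (q : Vec (Fin m) k) (w : Vec (Fin n) k) → Dec (OrderIso q w)
orderIso? q w = all? λ j → all? λ l → (lookup q j <? lookup q l) ⇔-dec (lookup w j <? lookup w l)

StrictlyMonotone : ∀ {m n} → (Fin m → Fin n) → Set
StrictlyMonotone f = ∀ x y → x < y → f x < f y

strictlyMonotone⇒⇔ : ∀ {m n} {f : Fin m → Fin n} → StrictlyMonotone f → ∀ x y → x < y ⇔ f x < f y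
strictlyMonotone⇒⇔ {f = f} f-mono x y = mk⇔ (f-mono x y) reflects
  where
  reflects : f x < f y → x < y
  reflects fx<fy with Fin.<-cmp x y
  ... | tri< x<y _    _   = x<y
  ... | tri≈ _   refl _   = contradiction fx<fy (Fin.<-irrefl refl)
  ... | tri> _   _    y<x = contradiction fx<fy (Fin.<-asym (f-mono y x y<x))

-- `StrictlyIncreasing` of a vector unfolds to `StrictlyMonotone` of its `lookup`, so this serves
-- both for positions and as a strictly monotone map from `Fin 3` into the values.
increasing₃ : ∀ {n} {x y z : Fin n} → x < y → y < z → StrictlyIncreasing (x ∷ y ∷ z ∷ [])
increasing₃ x<y y<z 0F 1F _ = x<y
increasing₃ x<y y<z 0F 2F _ = Fin.<-trans x<y y<z
increasing₃ x<y y<z 1F 2F _ = y<z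
increasing₃ x<y y<z 1F 1F (ℕ.s<s ())
increasing₃ x<y y<z 2F 1F (ℕ.s<s ())
increasing₃ x<y y<z 2F 2F (ℕ.s<s (ℕ.s<s ()))

orderIso-map : ∀ {k m n p} (q : Vec (Fin m) k) {f : Fin n → Fin p} → StrictlyMonotone f → ∀ w →
               OrderIso q w ⇔ OrderIso q (Vec.map f w)
orderIso-map q {f} f-mono w = mk⇔ (λ iso j l → step j l ⇔-∘ iso j l)
                                  (λ iso j l → ⇔-sym (step j l) ⇔-∘ iso j l)
  where
  step : ∀ j l → lookup w j < lookup w l ⇔ lookup (Vec.map f w) j < lookup (Vec.map f w) l
  step j l rewrite lookup-map j f w | lookup-map l f w =
    strictlyMonotone⇒⇔ f-mono (lookup w j) (lookup w l)

weight : ∀ {n} → Vec (Fin 3) 3 → Fin n → Fin n → Fin n → ℕ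
weight q x y z = indicator (orderIso? q (x ∷ y ∷ z ∷ []))

weight-mono : ∀ {m n} q {f : Fin m → Fin n} → StrictlyMonotone f → ∀ x y z →
              weight q (f x) (f y) (f z) ≡ weight q x y z
weight-mono q f-mono x y z =
  indicator-⇔ (orderIso? q (Vec.map _ w)) (orderIso? q w) (⇔-sym (orderIso-map q f-mono w))
  where w = x ∷ y ∷ z ∷ []

isOccurrence⇔orderIso : ∀ {n} q (σ : Vec (Fin n) n) {i j l} → i < j → j < l →
  IsOccurrence q σ (i ∷ j ∷ l ∷ []) ⇔ OrderIso q (lookup σ i ∷ lookup σ j ∷ lookup σ l ∷ [])
isOccurrence⇔orderIso q σ {i} {j} {l} i<j j<l =
  mk⇔ (λ (_ , iso) a b → subst₂ (compare a b) (sym (lookup-map a _ t)) (sym (lookup-map b _ t)) (iso a b))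
      (λ iso → increasing₃ i<j j<l ,
        λ a b → subst₂ (compare a b) (lookup-map a _ t) (lookup-map b _ t) (iso a b))
  where
  t = i ∷ j ∷ l ∷ []
  compare : ∀ a b → Fin _ → Fin _ → Set
  compare a b u v = lookup q a < lookup q b ⇔ u < v

occurrences≡tripleSum : ∀ {n} q (σ : Vec (Fin n) n) → occurrences q σ ≡ tripleSum (weight q) σ
occurrences≡tripleSum {n} q σ =
  trans (length-filter (isOccurrence? q σ) (words 3 n))
  (trans (sum-words 2 n f)
  (trans (sum-cong-≗ λ i → sum-words 1 n (f ∘ (i ∷_)))
  (trans (sum-cong-≗ λ i → sum-cong-≗ λ j → sum-words 0 n (λ w → f (i ∷ j ∷ w)))
  -- The `+ 0` is what remains of the sum over `words 0 n`, whose only member is the empty word.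
  (∑-triples (weight q) σ (λ i j l → f (i ∷ j ∷ l ∷ []) ℕ.+ 0) occurs misses))))
  where
  f : Vec (Fin n) 3 → ℕ
  f = indicator ∘ isOccurrence? q σ

  occurs : ∀ i j l → i < j → j < l →
           f (i ∷ j ∷ l ∷ []) ℕ.+ 0 ≡ weight q (lookup σ i) (lookup σ j) (lookup σ l)
  occurs i j l i<j j<l = trans (ℕ.+-identityʳ _)
    (indicator-⇔ (isOccurrence? q σ t) (orderIso? q (Vec.map (lookup σ) t)) (isOccurrence⇔orderIso q σ i<j j<l))
    where t = i ∷ j ∷ l ∷ []

  misses : ∀ i j l → ¬ (i < j × j < l) → f (i ∷ j ∷ l ∷ []) ℕ.+ 0 ≡ 0
  misses i j l ¬i<j<l = trans (ℕ.+-identityʳ _) (indicator-no (isOccurrence? q σ (i ∷ j ∷ l ∷ []))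
    λ (incr , _) → ¬i<j<l (incr 0F 1F ℕ.z<s , incr 1F 2F (ℕ.s<s ℕ.z<s)))

-- Binary codes and the words they describe

punchIn-mono : ∀ {n} (i : Fin (suc n)) → StrictlyMonotone (punchIn i)
punchIn-mono i x y x<y = ℕ.≰⇒> λ le → ℕ.<⇒≱ x<y (Fin.punchIn-cancel-≤ i y x le)

top : ∀ m → Fin (suc m)
top = fromℕ

second : ∀ m → Fin (suc (suc m))
second m = inject₁ (fromℕ m)

-- The first letter of a permutation avoiding 123 and 132 is its largest or its
-- second largest letter; true stands for the latter.
first : Bool → ∀ m → Fin (suc (suc m))
first false m = top (suc m)
first true  m = second m

-- The last letter leaves no choice, so m bits give m + 1 letters. `punchIn` relabels the shorter
-- word, in order, by the values different from the first letter.
decode : ∀ {m} → Vec Bool m → Vec (Fin (suc m)) (suc m)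
decode []              = zero ∷ []
decode {suc m} (b ∷ c) = first b m ∷ Vec.map (punchIn (first b m)) (decode c)

punchIn-top< : ∀ {m} (x : Fin (suc m)) → punchIn (top (suc m)) x < top (suc m)
punchIn-top< {m} x = Fin.≤∧≢⇒< (Fin.≤fromℕ _) (Fin.punchInᵢ≢i (top (suc m)) x)

-- Skipping the second largest value sends the maximum of the rest to the overall maximum: the one
-- later letter that is larger than a first letter of kind `true`.
punchIn-second-top : ∀ m → punchIn (second m) (top m) ≡ top (suc m)
punchIn-second-top zero    = refl
punchIn-second-top (suc m) = cong suc (punchIn-second-top m)

<top⇒≤second : ∀ m {x : Fin (suc (suc m))} → x < top (suc m) → x ≤ second m
<top⇒≤second m {x} x<top = subst (toℕ x ℕ.≤_) (sym (Fin.toℕ-inject₁ (fromℕ m))) (ℕ.s≤s⁻¹ x<top)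

second<top : ∀ m → second m < top (suc m)
second<top m = Fin.≤∧≢⇒< (Fin.≤fromℕ _) (Fin.fromℕ≢inject₁ ∘ sym)

-- Monotonicity keeps the image below the maximum, hence at most `second m`, and that value itself
-- is skipped.
punchIn-second< : ∀ {m} {x : Fin (suc m)} → x < top m → punchIn (second m) x < second m
punchIn-second< {m} {x} x<top = Fin.≤∧≢⇒< (<top⇒≤second m below) (Fin.punchInᵢ≢i (second m) x)
  where
  below : punchIn (second m) x < top (suc m)
  below = subst (punchIn (second m) x <_) (punchIn-second-top m) (punchIn-mono (second m) x (top m) x<top)

-- Counting pairs and triples of letters in a decoded word

vecSum-const : ∀ {A : Set} {n a} {h : A → ℕ} → (∀ x → h x ≡ a) → (v : Vec A n) →
               vecSum h v ≡ n ℕ.* a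
vecSum-const h≡a []      = refl
vecSum-const h≡a (x ∷ v) = cong₂ ℕ._+_ (h≡a x) (vecSum-const h≡a v)

-- A first letter `true` contributes `d` and leaves the maximum in the rest; a first letter `false`
-- contributes `a` and leaves only letters worth `d`. This serves the pairs that start with a second
-- largest letter: they are increasing with the maximum and decreasing with all others.
vecSum-decode : ∀ {m a d} {h : Fin (suc m) → ℕ} → h (top m) ≡ a → (∀ x → x < top m → h x ≡ d) →
                (c : Vec Bool m) → vecSum h (decode c) ≡ a ℕ.+ m ℕ.* d
vecSum-decode eq _ [] = cong (ℕ._+ 0) eq
vecSum-decode {suc m} {a} {d} {h} h-top h-rest (false ∷ c) = begin
  h (top (suc m)) ℕ.+ vecSum h (Vec.map (punchIn (top (suc m))) (decode c))
    ≡⟨ cong₂ ℕ._+_ h-top (vecSum-map h _ (decode c)) ⟩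
  a ℕ.+ vecSum (h ∘ punchIn (top (suc m))) (decode c)
    ≡⟨ cong (a ℕ.+_) (vecSum-const (λ x → h-rest _ (punchIn-top< x)) (decode c)) ⟩
  a ℕ.+ suc m ℕ.* d ∎
  where open ≡-Reasoning
vecSum-decode {suc m} {a} {d} {h} h-top h-rest (true ∷ c) = begin
  h (second m) ℕ.+ vecSum h (Vec.map (punchIn (second m)) (decode c))
    ≡⟨ cong₂ ℕ._+_ (h-rest _ (second<top m)) (vecSum-map h _ (decode c)) ⟩
  d ℕ.+ vecSum (h ∘ punchIn (second m)) (decode c)
    ≡⟨ cong (d ℕ.+_) (vecSum-decode (trans (cong h (punchIn-second-top m)) h-top)
         (λ x x<top → h-rest _ (Fin.<-trans (punchIn-second< x<top) (second<top m))) c) ⟩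
  d ℕ.+ (a ℕ.+ m ℕ.* d)
    ≡⟨ swap a d (m ℕ.* d) ⟩
  a ℕ.+ suc m ℕ.* d ∎
  where
  open ≡-Reasoning
  swap : ∀ a d e → d ℕ.+ (a ℕ.+ e) ≡ a ℕ.+ (d ℕ.+ e)
  swap = solve-∀

-- The maximum is written at the first `false`, or at the very end if there is none.
beforeTop : ∀ {m} → Vec Bool m → ℕ
beforeTop []          = 0
beforeTop (false ∷ c) = 0
beforeTop (true  ∷ c) = suc (beforeTop c)

afterTop : ∀ {m} → Vec Bool m → ℕ
afterTop []                  = 0
afterTop {suc m} (false ∷ c) = suc m
afterTop         (true  ∷ c) = afterTop c

-- Pairs in increasing (resp. decreasing) order, neither entry being the maximum.
increasingPairs : ∀ {m} → Vec Bool m → ℕ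
increasingPairs []          = 0
increasingPairs (false ∷ c) = beforeTop c ℕ.+ increasingPairs c
increasingPairs (true  ∷ c) = increasingPairs c

decreasingPairs : ∀ {m} → Vec Bool m → ℕ
decreasingPairs []                  = 0
decreasingPairs         (false ∷ c) = afterTop c ℕ.+ decreasingPairs c
decreasingPairs {suc m} (true  ∷ c) = m ℕ.+ decreasingPairs c

-- Pairs fall into four classes: ending in the maximum, starting with it, or increasing or
-- decreasing without it. The four constants are arguments because a recursive call may need other
-- ones.
pairSum-decode : ∀ {m} (h : Fin (suc m) → Fin (suc m) → ℕ) a b c d →
  (∀ y → y < top m → h y (top m) ≡ a) →
  (∀ z → z < top m → h (top m) z ≡ b) →
  (∀ y z → y < z → z < top m → h y z ≡ c) →
  (∀ y z → z < y → y < top m → h y z ≡ d) →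
  (w : Vec Bool m) →
  pairSum h (decode w) ≡
    beforeTop w ℕ.* a ℕ.+ afterTop w ℕ.* b ℕ.+ increasingPairs w ℕ.* c ℕ.+ decreasingPairs w ℕ.* d
pairSum-decode h a b c d _ _ _ _ [] = refl
pairSum-decode {suc m} h a b c d h-a h-b h-c h-d (false ∷ w) = begin
  vecSum (h (top (suc m))) (Vec.map p (decode w)) ℕ.+ pairSum h (Vec.map p (decode w))
    ≡⟨ cong₂ ℕ._+_ (vecSum-map _ p (decode w)) (pairSum-map h p (decode w)) ⟩
  vecSum (h (top (suc m)) ∘ p) (decode w) ℕ.+ pairSum (λ y z → h (p y) (p z)) (decode w)
    ≡⟨ cong₂ ℕ._+_
         (vecSum-const (λ z → h-b _ (punchIn-top< z)) (decode w))
         -- Behind a new maximum, the old one is an ordinary letter: its pairs are now worth `c` and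
         -- `d`.
         (pairSum-decode _ c d c d
           (λ y y<top → h-c _ _ (p-mono _ _ y<top) (punchIn-top< _))
           (λ z z<top → h-d _ _ (p-mono _ _ z<top) (punchIn-top< _))
           (λ y z y<z _ → h-c _ _ (p-mono _ _ y<z) (punchIn-top< _))
           (λ y z z<y _ → h-d _ _ (p-mono _ _ z<y) (punchIn-top< _)) w) ⟩
  suc m ℕ.* b ℕ.+ (beforeTop w ℕ.* c ℕ.+ afterTop w ℕ.* d ℕ.+ increasingPairs w ℕ.* c ℕ.+ decreasingPairs w ℕ.* d)
    ≡⟨ regroup (suc m) (beforeTop w) (afterTop w) (increasingPairs w) (decreasingPairs w) b c d ⟩
  suc m ℕ.* b ℕ.+ (beforeTop w ℕ.+ increasingPairs w) ℕ.* c ℕ.+ (afterTop w ℕ.+ decreasingPairs w) ℕ.* d ∎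
  where
  open ≡-Reasoning
  p      = punchIn (top (suc m))
  p-mono = punchIn-mono (top (suc m))
  regroup : ∀ k l r i j b c d → k ℕ.* b ℕ.+ (l ℕ.* c ℕ.+ r ℕ.* d ℕ.+ i ℕ.* c ℕ.+ j ℕ.* d) ≡
                                k ℕ.* b ℕ.+ (l ℕ.+ i) ℕ.* c ℕ.+ (r ℕ.+ j) ℕ.* d
  regroup = solve-∀
pairSum-decode {suc m} h a b c d h-a h-b h-c h-d (true ∷ w) = begin
  vecSum (h (second m)) (Vec.map p (decode w)) ℕ.+ pairSum h (Vec.map p (decode w))
    ≡⟨ cong₂ ℕ._+_ (vecSum-map _ p (decode w)) (pairSum-map h p (decode w)) ⟩
  vecSum (h (second m) ∘ p) (decode w) ℕ.+ pairSum (λ y z → h (p y) (p z)) (decode w)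
    ≡⟨ cong₂ ℕ._+_
         (vecSum-decode (trans (cong (h (second m)) p-top) (h-a _ (second<top m)))
           (λ z z<top → h-d _ _ (punchIn-second< z<top) (second<top m)) w)
         -- The maximum of the rest remains the maximum, so the constants are kept.
         (pairSum-decode _ a b c d
           (λ y y<top → trans (cong (h (p y)) p-top) (h-a _ (p<top y<top)))
           (λ z z<top → trans (cong (λ x → h x (p z)) p-top) (h-b _ (p<top z<top)))
           (λ y z y<z z<top → h-c _ _ (p-mono _ _ y<z) (p<top z<top))
           (λ y z z<y y<top → h-d _ _ (p-mono _ _ z<y) (p<top y<top)) w) ⟩
  (a ℕ.+ m ℕ.* d) ℕ.+ (beforeTop w ℕ.* a ℕ.+ afterTop w ℕ.* b ℕ.+ increasingPairs w ℕ.* c ℕ.+ decreasingPairs w ℕ.* d)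
    ≡⟨ regroup m (beforeTop w) (afterTop w) (increasingPairs w) (decreasingPairs w) a b c d ⟩
  suc (beforeTop w) ℕ.* a ℕ.+ afterTop w ℕ.* b ℕ.+ increasingPairs w ℕ.* c ℕ.+ (m ℕ.+ decreasingPairs w) ℕ.* d ∎
  where
  open ≡-Reasoning
  p      = punchIn (second m)
  p-mono = punchIn-mono (second m)
  p-top  = punchIn-second-top m
  p<top : ∀ {x} → x < top m → p x < top (suc m)
  p<top x<top = Fin.<-trans (punchIn-second< x<top) (second<top m)
  regroup : ∀ k l r i j a b c d → (a ℕ.+ k ℕ.* d) ℕ.+ (l ℕ.* a ℕ.+ r ℕ.* b ℕ.+ i ℕ.* c ℕ.+ j ℕ.* d) ≡
                                  suc l ℕ.* a ℕ.+ r ℕ.* b ℕ.+ i ℕ.* c ℕ.+ (k ℕ.+ j) ℕ.* d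
  regroup = solve-∀

-- The four recursions add the pairs that complete the pattern with the first letter. After a second
-- largest letter, pairs ending or starting in the maximum give 213 or 231, and the other pairs 312
-- or 321 by their order. After a largest letter, every pair gives 312 or 321.
count213 : ∀ {m} → Vec Bool m → ℕ
count213 []          = 0
count213 (false ∷ w) = count213 w
count213 (true  ∷ w) = beforeTop w ℕ.+ count213 w

count231 : ∀ {m} → Vec Bool m → ℕ
count231 []          = 0
count231 (false ∷ w) = count231 w
count231 (true  ∷ w) = afterTop w ℕ.+ count231 w

count312 : ∀ {m} → Vec Bool m → ℕ
count312 []          = 0
count312 (false ∷ w) = beforeTop w ℕ.+ increasingPairs w ℕ.+ count312 w
count312 (true  ∷ w) = increasingPairs w ℕ.+ count312 w

count321 : ∀ {m} → Vec Bool m → ℕ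
count321 []          = 0
count321 (false ∷ w) = afterTop w ℕ.+ decreasingPairs w ℕ.+ count321 w
count321 (true  ∷ w) = decreasingPairs w ℕ.+ count321 w

-- Triples ordered like 123 or 132 never arise, so they have no term on the right; for the weights
-- of these two patterns the identity therefore proves avoidance.
tripleSum-decode : ∀ {m} (h : Fin (suc m) → Fin (suc m) → Fin (suc m) → ℕ) a b c d →
  (∀ x y z → y < x → x < z → h x y z ≡ a) →
  (∀ x y z → z < x → x < y → h x y z ≡ b) →
  (∀ x y z → y < z → z < x → h x y z ≡ c) →
  (∀ x y z → z < y → y < x → h x y z ≡ d) →
  (w : Vec Bool m) →
  tripleSum h (decode w) ≡
    count213 w ℕ.* a ℕ.+ count231 w ℕ.* b ℕ.+ count312 w ℕ.* c ℕ.+ count321 w ℕ.* d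
tripleSum-decode h a b c d _ _ _ _ [] = refl
tripleSum-decode {suc m} h a b c d h-a h-b h-c h-d (x ∷ w) = begin
  pairSum (h (first x m)) (Vec.map p (decode w)) ℕ.+ tripleSum h (Vec.map p (decode w))
    ≡⟨ cong₂ ℕ._+_ (pairSum-map _ p (decode w)) (tripleSum-map h p (decode w)) ⟩
  pairSum (λ y z → h (first x m) (p y) (p z)) (decode w) ℕ.+
  tripleSum (λ x y z → h (p x) (p y) (p z)) (decode w)
    ≡⟨ cong₂ ℕ._+_ refl (tripleSum-decode _ a b c d
         (λ x y z y<x x<z → h-a _ _ _ (p-mono _ _ y<x) (p-mono _ _ x<z))
         (λ x y z z<x x<y → h-b _ _ _ (p-mono _ _ z<x) (p-mono _ _ x<y))
         (λ x y z y<z z<x → h-c _ _ _ (p-mono _ _ y<z) (p-mono _ _ z<x))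
         (λ x y z z<y y<x → h-d _ _ _ (p-mono _ _ z<y) (p-mono _ _ y<x)) w) ⟩
  pairSum (λ y z → h (first x m) (p y) (p z)) (decode w) ℕ.+
  (count213 w ℕ.* a ℕ.+ count231 w ℕ.* b ℕ.+ count312 w ℕ.* c ℕ.+ count321 w ℕ.* d)
    ≡⟨ startingAtFirst x ⟩
  _ ∎
  where
  open ≡-Reasoning
  p      = punchIn (first x m)
  p-mono = punchIn-mono (first x m)

  regroup-top : ∀ l r i j s t u v a b c d →
    (l ℕ.* c ℕ.+ r ℕ.* d ℕ.+ i ℕ.* c ℕ.+ j ℕ.* d) ℕ.+ (s ℕ.* a ℕ.+ t ℕ.* b ℕ.+ u ℕ.* c ℕ.+ v ℕ.* d) ≡
    s ℕ.* a ℕ.+ t ℕ.* b ℕ.+ (l ℕ.+ i ℕ.+ u) ℕ.* c ℕ.+ (r ℕ.+ j ℕ.+ v) ℕ.* d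
  regroup-top = solve-∀

  regroup-second : ∀ l r i j s t u v a b c d →
    (l ℕ.* a ℕ.+ r ℕ.* b ℕ.+ i ℕ.* c ℕ.+ j ℕ.* d) ℕ.+ (s ℕ.* a ℕ.+ t ℕ.* b ℕ.+ u ℕ.* c ℕ.+ v ℕ.* d) ≡
    (l ℕ.+ s) ℕ.* a ℕ.+ (r ℕ.+ t) ℕ.* b ℕ.+ (i ℕ.+ u) ℕ.* c ℕ.+ (j ℕ.+ v) ℕ.* d
  regroup-second = solve-∀

  startingAtFirst : ∀ x →
    pairSum (λ y z → h (first x m) (punchIn (first x m) y) (punchIn (first x m) z)) (decode w) ℕ.+
      (count213 w ℕ.* a ℕ.+ count231 w ℕ.* b ℕ.+ count312 w ℕ.* c ℕ.+ count321 w ℕ.* d) ≡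
    count213 (x ∷ w) ℕ.* a ℕ.+ count231 (x ∷ w) ℕ.* b ℕ.+ count312 (x ∷ w) ℕ.* c ℕ.+ count321 (x ∷ w) ℕ.* d
  -- All pairs lie below the first letter, so those containing the maximum of the rest are
  -- classified by their order alone.
  startingAtFirst false = trans (cong (ℕ._+ _) (pairSum-decode _ c d c d
      (λ y y<top → h-c _ _ _ (mono _ _ y<top) (punchIn-top< _))
      (λ z z<top → h-d _ _ _ (mono _ _ z<top) (punchIn-top< _))
      (λ y z y<z _ → h-c _ _ _ (mono _ _ y<z) (punchIn-top< _))
      (λ y z z<y _ → h-d _ _ _ (mono _ _ z<y) (punchIn-top< _)) w))
    (regroup-top (beforeTop w) (afterTop w) (increasingPairs w) (decreasingPairs w)
      (count213 w) (count231 w) (count312 w) (count321 w) a b c d)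
    where mono = punchIn-mono (top (suc m))
  startingAtFirst true = trans (cong (ℕ._+ _) (pairSum-decode _ a b c d
      (λ y y<top → h-a _ _ _ (punchIn-second< y<top) second<)
      (λ z z<top → h-b _ _ _ (punchIn-second< z<top) second<)
      (λ y z y<z z<top → h-c _ _ _ (mono _ _ y<z) (punchIn-second< z<top))
      (λ y z z<y y<top → h-d _ _ _ (mono _ _ z<y) (punchIn-second< y<top)) w))
    (regroup-second (beforeTop w) (afterTop w) (increasingPairs w) (decreasingPairs w)
      (count213 w) (count231 w) (count312 w) (count321 w) a b c d)
    where
    mono = punchIn-mono (second m)
    second< : second m < punchIn (second m) (top m)
    second< = subst (second m <_) (sym (punchIn-second-top m)) (second<top m)

-- Three distinct letters are the image of their own pattern under the strictly monotone map from
-- `Fin 3` that lists them in increasing order, so the weight depends on that pattern only. For a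
-- concrete `q` the four coefficients compute to 0 or 1.
occurrences-decode : ∀ {m} q (w : Vec Bool m) → occurrences q (decode w) ≡
  count213 w ℕ.* indicator (orderIso? q p213) ℕ.+ count231 w ℕ.* indicator (orderIso? q p231) ℕ.+
  count312 w ℕ.* indicator (orderIso? q p312) ℕ.+ count321 w ℕ.* indicator (orderIso? q p321)
occurrences-decode q w = trans (occurrences≡tripleSum q (decode w))
  (tripleSum-decode (weight q) _ _ _ _
    (λ x y z y<x x<z → weight-mono q (increasing₃ y<x x<z) 1F 0F 2F)
    (λ x y z z<x x<y → weight-mono q (increasing₃ z<x x<y) 1F 2F 0F)
    (λ x y z y<z z<x → weight-mono q (increasing₃ y<z z<x) 2F 0F 1F)
    (λ x y z z<y y<x → weight-mono q (increasing₃ z<y y<x) 2F 1F 0F) w)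

-- Removing and prepending the first letter

isPermutation-∷⁺ : ∀ {n} {x : Fin (suc n)} {τ : Vec (Fin n) n} →
                   IsPermutation τ → IsPermutation (x ∷ Vec.map (punchIn x) τ)
isPermutation-∷⁺ {x = x} {τ} (inj , surj) =
  (λ {i} {j} → injective i j) , strictlySurjective⇒surjective surjective
  where
  σ = x ∷ Vec.map (punchIn x) τ

  injective : ∀ i j → lookup σ i ≡ lookup σ j → i ≡ j
  injective zero    zero    _  = refl
  injective zero    (suc j) eq = contradiction (sym (trans eq (lookup-map j _ τ))) (Fin.punchInᵢ≢i x _)
  injective (suc i) zero    eq = contradiction (trans (sym (lookup-map i _ τ)) eq) (Fin.punchInᵢ≢i x _)
  injective (suc i) (suc j) eq = cong suc (inj (Fin.punchIn-injective x _ _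
    (trans (sym (lookup-map i _ τ)) (trans eq (lookup-map j _ τ)))))

  surjective : StrictlySurjective _≡_ (lookup σ)
  surjective y with x ≟ y
  ... | yes x≡y = zero , x≡y
  ... | no  x≢y with i , eq ← surjective⇒strictlySurjective surj (punchOut x≢y) =
    suc i , trans (lookup-map i _ τ) (trans (cong (punchIn x) eq) (Fin.punchIn-punchOut x≢y))

isPermutation-∷⁻ : ∀ {n} {x : Fin (suc n)} {τ : Vec (Fin n) n} →
                   IsPermutation (x ∷ Vec.map (punchIn x) τ) → IsPermutation τ
isPermutation-∷⁻ {x = x} {τ} (inj , surj) =
  (λ {i} {j} eq → Fin.suc-injective
    (inj (trans (lookup-map i _ τ) (trans (cong (punchIn x) eq) (sym (lookup-map j _ τ)))))) ,
  strictlySurjective⇒surjective surjective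
  where
  surjective : StrictlySurjective _≡_ (lookup τ)
  surjective y with surjective⇒strictlySurjective surj (punchIn x y)
  ... | zero  , eq = contradiction (sym eq) (Fin.punchInᵢ≢i x y)
  ... | suc i , eq = i , Fin.punchIn-injective x _ _ (trans (sym (lookup-map i _ τ)) eq)

unpunch : ∀ {n k} {x : Fin (suc n)} (v : Vec (Fin (suc n)) k) → (∀ i → x ≢ lookup v i) →
          ∃ λ τ → v ≡ Vec.map (punchIn x) τ
unpunch []      x≢v = [] , refl
unpunch (y ∷ v) x≢v with τ , eq ← unpunch v (x≢v ∘ suc) =
  punchOut (x≢v zero) ∷ τ , cong₂ _∷_ (sym (Fin.punchIn-punchOut (x≢v zero))) eq

-- The triples inside the tail form one summand of the sum over all triples, and a vanishing sum of
-- naturals has vanishing summands; `punchIn` does not change the weights.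
avoids-∷⁻ : ∀ {n} q (x : Fin (suc n)) (τ : Vec (Fin n) n) →
            Avoids q (x ∷ Vec.map (punchIn x) τ) → Avoids q τ
avoids-∷⁻ q x τ avoids = begin
  occurrences q τ
    ≡⟨ occurrences≡tripleSum q τ ⟩
  tripleSum (weight q) τ
    ≡⟨ tripleSum-cong (weight-mono q (punchIn-mono x)) τ ⟨
  tripleSum (λ a b c → weight q (punchIn x a) (punchIn x b) (punchIn x c)) τ
    ≡⟨ tripleSum-map (weight q) (punchIn x) τ ⟨
  tripleSum (weight q) (Vec.map (punchIn x) τ)
    ≡⟨ ℕ.m+n≡0⇒n≡0 (pairSum (weight q x) (Vec.map (punchIn x) τ))
         (trans (sym (occurrences≡tripleSum q (x ∷ Vec.map (punchIn x) τ))) avoids) ⟩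
  0 ∎
  where open ≡-Reasoning

-- Every avoider has a code

∈-words : ∀ {k n} (w : Vec (Fin n) k) → w ∈ words k n
∈-words []      = here refl
∈-words (x ∷ w) = ∈-cartesianProductWith⁺ _∷_ (∈-allFin x) (∈-words w)

avoids⇒¬isOccurrence : ∀ {k n} (q : Vec (Fin k) k) (σ : Vec (Fin n) n) →
                       Avoids q σ → ∀ i → ¬ IsOccurrence q σ i
avoids⇒¬isOccurrence q σ avoids i occ =
  ℕ.<-irrefl (sym avoids) (∈-length {x = i} (∈-filter⁺ (isOccurrence? q σ) (∈-words i) occ))

IsAvoider : ∀ {n} → Vec (Fin n) n → Set
IsAvoider σ = Avoids p123 σ × Avoids p132 σ

isAvoider? : ∀ {n} (σ : Vec (Fin n) n) → Dec (IsAvoider σ)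
isAvoider? σ = avoids? p123 σ ×-dec avoids? p132 σ

<second : ∀ {m x} → x ≢ top (suc m) → x ≢ second m → x < second m
<second {m} x≢top x≢second = Fin.≤∧≢⇒< (<top⇒≤second m (Fin.≤∧≢⇒< (Fin.≤fromℕ _) x≢top)) x≢second

0<position : ∀ {A : Set} {n x y} {v : Vec A n} {i} → lookup (x ∷ v) i ≡ y → x ≢ y → zero {n} < i
0<position {i = zero}  x≡y x≢y = contradiction x≡y x≢y
0<position {i = suc i} _   _   = ℕ.z<s

-- Surjectivity locates the two largest values. If the first letter is neither, both come after it
-- and complete 123 or 132, according to which of them comes first.
first-of-avoider : ∀ {m x} {v : Vec (Fin (suc (suc m))) (suc m)} →
                   IsPermutation (x ∷ v) → IsAvoider (x ∷ v) → ∃ λ b → x ≡ first b m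
first-of-avoider {m} {x} {v} (_ , surj) (avoids-123 , avoids-132) = decide (x ≟ top (suc m)) (x ≟ second m)
  where
  module _ (x≢top : x ≢ top (suc m)) (x≢second : x ≢ second m) where

    -- Reading the letters x < second < top in the order prescribed by `q` transports the identity
    -- isomorphism of `q`, so one argument covers 123 and 132.
    largest-three : ∀ q → OrderIso q (Vec.map (lookup (x ∷ second m ∷ top (suc m) ∷ [])) q)
    largest-three q = Equivalence.to
      (orderIso-map q (increasing₃ (<second x≢top x≢second) (second<top m)) q) λ _ _ → mk⇔ id id

    clash : ∀ {i j} → lookup (x ∷ v) i ≡ second m → lookup (x ∷ v) j ≡ top (suc m) → ⊥
    clash {i} {j} σᵢ σⱼ = by-position (Fin.<-cmp i j)
      where
      by-position : Tri (i < j) (i ≡ j) (j < i) → ⊥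
      by-position (tri≈ _ refl _) = Fin.fromℕ≢inject₁ (trans (sym σⱼ) σᵢ)
      by-position (tri< i<j _ _) = avoids⇒¬isOccurrence p123 (x ∷ v) avoids-123 (0F ∷ i ∷ j ∷ [])
        (Equivalence.from (isOccurrence⇔orderIso p123 (x ∷ v) (0<position σᵢ x≢second) i<j)
          (subst₂ (λ y z → OrderIso p123 (x ∷ y ∷ z ∷ [])) (sym σᵢ) (sym σⱼ) (largest-three p123)))
      by-position (tri> _ _ j<i) = avoids⇒¬isOccurrence p132 (x ∷ v) avoids-132 (0F ∷ j ∷ i ∷ [])
        (Equivalence.from (isOccurrence⇔orderIso p132 (x ∷ v) (0<position σⱼ x≢top) j<i)
          (subst₂ (λ y z → OrderIso p132 (x ∷ y ∷ z ∷ [])) (sym σⱼ) (sym σᵢ) (largest-three p132)))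

  decide : Dec (x ≡ top (suc m)) → Dec (x ≡ second m) → ∃ λ b → x ≡ first b m
  decide (yes x≡top) _              = false , x≡top
  decide (no _)      (yes x≡second) = true , x≡second
  decide (no x≢top)  (no x≢second)  =
    let i , σᵢ = surjective⇒strictlySurjective surj (second m)
        j , σⱼ = surjective⇒strictlySurjective surj (top (suc m))
    in contradiction σⱼ (clash x≢top x≢second {i} {j} σᵢ)

decode-isPermutation : ∀ {m} (w : Vec Bool m) → IsPermutation (decode w)
decode-isPermutation []      = (λ { {0F} {0F} _ → refl }) , λ { 0F → 0F , λ { refl → refl } }
decode-isPermutation (b ∷ w) = isPermutation-∷⁺ (decode-isPermutation w)

vanishing-combination : ∀ a b c d → a ℕ.* 0 ℕ.+ b ℕ.* 0 ℕ.+ c ℕ.* 0 ℕ.+ d ℕ.* 0 ≡ 0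
vanishing-combination = solve-∀

decode-avoids-123 : ∀ {m} (w : Vec Bool m) → Avoids p123 (decode w)
decode-avoids-123 w = trans (occurrences-decode p123 w)
  (vanishing-combination (count213 w) (count231 w) (count312 w) (count321 w))

decode-avoids-132 : ∀ {m} (w : Vec Bool m) → Avoids p132 (decode w)
decode-avoids-132 w = trans (occurrences-decode p132 w)
  (vanishing-combination (count213 w) (count231 w) (count312 w) (count321 w))

decode-surjective : ∀ {m} (σ : Vec (Fin (suc m)) (suc m)) → IsPermutation σ → IsAvoider σ →
                    ∃ λ w → σ ≡ decode w
decode-surjective {zero}  (0F ∷ []) _    _      = [] , refl
decode-surjective {suc m} (x ∷ v)   perm avoids =
  prepend (first-of-avoider perm avoids)
          (unpunch v (λ i eq → Fin.0≢1+n (proj₁ perm {0F} {suc i} eq))) perm avoids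
  where
  prepend : ∀ {x v} → (∃ λ b → x ≡ first b m) → (∃ λ τ → v ≡ Vec.map (punchIn x) τ) →
            IsPermutation (x ∷ v) → IsAvoider (x ∷ v) → ∃ λ w → x ∷ v ≡ decode w
  prepend (b , refl) (τ , refl) perm (avoids-123 , avoids-132) =
    let w , τ≡ = decode-surjective τ (isPermutation-∷⁻ perm)
                   (avoids-∷⁻ p123 (first b m) τ avoids-123 , avoids-∷⁻ p132 (first b m) τ avoids-132)
    in b ∷ w , cong (λ τ → first b m ∷ Vec.map (punchIn (first b m)) τ) τ≡

-- Listing the avoiders by their codes

first-injective : ∀ {m} a b → first a m ≡ first b m → a ≡ b
first-injective false false _  = refl
first-injective false true  eq = contradiction eq Fin.fromℕ≢inject₁
first-injective true  false eq = contradiction (sym eq) Fin.fromℕ≢inject₁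
first-injective true  true  _  = refl

Vec-map-injective : ∀ {A B : Set} {f : A → B} → (∀ {x y} → f x ≡ f y → x ≡ y) →
                    ∀ {n} {u v : Vec A n} → Vec.map f u ≡ Vec.map f v → u ≡ v
Vec-map-injective f-inj {u = []}    {[]}    _  = refl
Vec-map-injective f-inj {u = x ∷ u} {y ∷ v} eq =
  cong₂ _∷_ (f-inj (Vec.∷-injectiveˡ eq)) (Vec-map-injective f-inj (Vec.∷-injectiveʳ eq))

decode-injective : ∀ {m} {u w : Vec Bool m} → decode u ≡ decode w → u ≡ w
decode-injective {u = []}    {[]}    _  = refl
decode-injective {u = a ∷ u} {b ∷ w} eq with refl ← first-injective a b (Vec.∷-injectiveˡ eq) =
  cong (a ∷_) (decode-injective (Vec-map-injective (Fin.punchIn-injective _ _ _) (Vec.∷-injectiveʳ eq)))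

codes : ∀ m → List (Vec Bool m)
codes zero    = [] ∷ []
codes (suc m) = cartesianProductWith _∷_ (false ∷ true ∷ []) (codes m)

∈-codes : ∀ {m} (w : Vec Bool m) → w ∈ codes m
∈-codes []          = here refl
∈-codes (false ∷ w) = ∈-cartesianProductWith⁺ _∷_ {false ∷ true ∷ []} (here refl) (∈-codes w)
∈-codes (true  ∷ w) = ∈-cartesianProductWith⁺ _∷_ {false ∷ true ∷ []} (there (here refl)) (∈-codes w)

words-unique : ∀ k n → Unique (words k n)
words-unique zero    n = [] ∷ []
words-unique (suc k) n = Unique.cartesianProductWith⁺ _∷_ Vec.∷-injective (Unique.allFin⁺ n) (words-unique k n)

codes-unique : ∀ m → Unique (codes m)
codes-unique zero    = [] ∷ []
codes-unique (suc m) = Unique.cartesianProductWith⁺ _∷_ Vec.∷-injective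
  (((λ ()) ∷ []) ∷ [] ∷ []) (codes-unique m)

∈-S[123,132]⁺ : ∀ {n} (σ : Vec (Fin n) n) → IsPermutation σ → IsAvoider σ → σ ∈ S[123,132] n
∈-S[123,132]⁺ σ perm avoids =
  ∈-filter⁺ isAvoider? (∈-filter⁺ isPermutation? (∈-words σ) perm) avoids

∈-S[123,132]⁻ : ∀ {n} (σ : Vec (Fin n) n) → σ ∈ S[123,132] n → IsPermutation σ × IsAvoider σ
∈-S[123,132]⁻ {n} σ σ∈ = let σ∈S , avoids = ∈-filter⁻ isAvoider? {σ} {S n} σ∈ in
  proj₂ (∈-filter⁻ isPermutation? {σ} {words n n} σ∈S) , avoids

S[123,132]-unique : ∀ n → Unique (S[123,132] n)
S[123,132]-unique n = Unique.filter⁺ isAvoider? (Unique.filter⁺ isPermutation? (words-unique n n))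

-- Both lists are free of duplicates, so having the same members makes them rearrangements of each
-- other.
S[123,132]↭decode : ∀ m → S[123,132] (suc m) ↭ map decode (codes m)
S[123,132]↭decode m = ∼bag⇒↭ (unique∧set⇒bag
  (S[123,132]-unique (suc m)) (Unique.map⁺ decode-injective (codes-unique m)) (mk⇔ encodable decodable))
  where
  image : ∀ {σ} → (∃ λ w → σ ≡ decode w) → σ ∈ map decode (codes m)
  image (w , refl) = ∈-map⁺ decode (∈-codes w)

  encodable : ∀ {σ} → σ ∈ S[123,132] (suc m) → σ ∈ map decode (codes m)
  encodable {σ} σ∈ = let perm , avoids = ∈-S[123,132]⁻ σ σ∈ in image (decode-surjective σ perm avoids)

  decodable′ : ∀ {σ} → (∃ λ w → w ∈ codes m × σ ≡ decode w) → σ ∈ S[123,132] (suc m)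
  decodable′ (w , _ , refl) =
    ∈-S[123,132]⁺ (decode w) (decode-isPermutation w) (decode-avoids-123 w , decode-avoids-132 w)

  decodable : ∀ {σ} → σ ∈ map decode (codes m) → σ ∈ S[123,132] (suc m)
  decodable σ∈ = decodable′ (∈-map⁻ decode σ∈)

total-decode : ∀ (q : Vec (Fin 3) 3) m → total q (suc m) ≡ sum (map (occurrences q ∘ decode) (codes m))
total-decode q m = trans (sum-↭ (map⁺ (occurrences q) (S[123,132]↭decode m))) (cong sum (sym (List.map-∘ (codes m))))

-- Sums of the statistics over all codes

∑codes : ∀ {m} → (Vec Bool m → ℕ) → ℕ
∑codes f = sum (map f (codes _))

∑codes-suc : ∀ {m} (f : Vec Bool (suc m) → ℕ) →
             ∑codes f ≡ ∑codes (f ∘ (false ∷_)) ℕ.+ ∑codes (f ∘ (true ∷_))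
∑codes-suc {m} f = trans (sum-cartesianProductWith _∷_ f (false ∷ true ∷ []) (codes m))
  (cong (∑codes (f ∘ (false ∷_)) ℕ.+_) (ℕ.+-identityʳ _))

sum-map-+ : ∀ {A : Set} (f g : A → ℕ) xs →
            sum (map (λ x → f x ℕ.+ g x) xs) ≡ sum (map f xs) ℕ.+ sum (map g xs)
sum-map-+ f g []       = refl
sum-map-+ f g (x ∷ xs) = trans (cong (f x ℕ.+ g x ℕ.+_) (sum-map-+ f g xs)) (interchange (f x) (g x) _ _)
  where
  interchange : ∀ a b c d → a ℕ.+ b ℕ.+ (c ℕ.+ d) ≡ a ℕ.+ c ℕ.+ (b ℕ.+ d)
  interchange = solve-∀

∑codes-+ : ∀ m (f g : Vec Bool m → ℕ) → ∑codes (λ w → f w ℕ.+ g w) ≡ ∑codes f ℕ.+ ∑codes g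
∑codes-+ m f g = sum-map-+ f g (codes m)

∑codes-const : ∀ m a → ∑codes {m} (λ _ → a) ≡ a ℕ.* 2 ^ m
∑codes-const zero    a = trans (ℕ.+-identityʳ a) (sym (ℕ.*-identityʳ a))
∑codes-const (suc m) a = trans (∑codes-suc {m} (λ _ → a))
  (trans (cong₂ ℕ._+_ (∑codes-const m a) (∑codes-const m a)) (double a (2 ^ m)))
  where
  double : ∀ a e → a ℕ.* e ℕ.+ a ℕ.* e ≡ a ℕ.* (2 ℕ.* e)
  double = solve-∀

-- A leading `true` adds 1 for each of the 2^m tails, a leading `false` resets the count to 0. The 1
-- on the left replaces a subtraction on the right.
∑beforeTop : ∀ m → ∑codes {m} beforeTop ℕ.+ 1 ≡ 2 ^ m
∑beforeTop zero    = refl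
∑beforeTop (suc m) = begin
  ∑codes {suc m} beforeTop ℕ.+ 1
    ≡⟨ cong (ℕ._+ 1) (trans (∑codes-suc {m} beforeTop)
         (cong₂ ℕ._+_ (∑codes-const m 0) (trans (∑codes-+ m (λ _ → 1) beforeTop) (cong (ℕ._+ ∑codes {m} beforeTop) (∑codes-const m 1))))) ⟩
  1 ℕ.* 2 ^ m ℕ.+ ∑codes {m} beforeTop ℕ.+ 1
    ≡⟨ ℕ.+-assoc (1 ℕ.* 2 ^ m) _ 1 ⟩
  1 ℕ.* 2 ^ m ℕ.+ (∑codes {m} beforeTop ℕ.+ 1)
    ≡⟨ cong (1 ℕ.* 2 ^ m ℕ.+_) (∑beforeTop m) ⟩
  1 ℕ.* 2 ^ m ℕ.+ 2 ^ m
    ≡⟨ double (2 ^ m) ⟩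
  2 ^ suc m ∎
  where
  open ≡-Reasoning
  double : ∀ e → 1 ℕ.* e ℕ.+ e ≡ 2 ℕ.* e
  double = solve-∀

∑afterTop : ∀ m → ∑codes {suc m} afterTop ≡ m ℕ.* 2 ^ suc m ℕ.+ 1
∑afterTop zero    = refl
∑afterTop (suc m) = begin
  ∑codes {suc (suc m)} afterTop
    ≡⟨ ∑codes-suc {suc m} afterTop ⟩
  ∑codes {suc m} (λ _ → suc (suc m)) ℕ.+ ∑codes {suc m} afterTop
    ≡⟨ cong₂ ℕ._+_ (∑codes-const (suc m) (suc (suc m))) (∑afterTop m) ⟩
  suc (suc m) ℕ.* 2 ^ suc m ℕ.+ (m ℕ.* 2 ^ suc m ℕ.+ 1)
    ≡⟨ collect m (2 ^ suc m) ⟩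
  suc m ℕ.* 2 ^ suc (suc m) ℕ.+ 1 ∎
  where
  open ≡-Reasoning
  collect : ∀ m e → suc (suc m) ℕ.* e ℕ.+ (m ℕ.* e ℕ.+ 1) ≡ suc m ℕ.* (2 ℕ.* e) ℕ.+ 1
  collect = solve-∀

-- A new maximum in front turns the pairs ending in the old one into ordinary increasing pairs, so
-- the sum doubles and grows by that of `beforeTop`. From here on, codes of length 2 + k stand for
-- permutations of length n = 3 + k, which keeps subtraction out of polynomials and exponents.
∑increasingPairs : ∀ k → ∑codes {2 ℕ.+ k} increasingPairs ≡ k ℕ.* 2 ^ suc k ℕ.+ 1
∑increasingPairs zero    = refl
∑increasingPairs (suc k) = begin
  ∑codes {3 ℕ.+ k} increasingPairs
    ≡⟨ trans (∑codes-suc {2 ℕ.+ k} increasingPairs) (cong (ℕ._+ i) (∑codes-+ (2 ℕ.+ k) beforeTop increasingPairs)) ⟩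
  b ℕ.+ i ℕ.+ i
    ≡⟨ cong (λ i → b ℕ.+ i ℕ.+ i) (∑increasingPairs k) ⟩
  b ℕ.+ (k ℕ.* e ℕ.+ 1) ℕ.+ (k ℕ.* e ℕ.+ 1)
    ≡⟨ isolate b (k ℕ.* e) ⟩
  (b ℕ.+ 1) ℕ.+ (k ℕ.* e ℕ.+ k ℕ.* e ℕ.+ 1)
    ≡⟨ cong (ℕ._+ (k ℕ.* e ℕ.+ k ℕ.* e ℕ.+ 1)) (∑beforeTop (2 ℕ.+ k)) ⟩
  2 ℕ.* e ℕ.+ (k ℕ.* e ℕ.+ k ℕ.* e ℕ.+ 1)
    ≡⟨ collect k e ⟩
  suc k ℕ.* (2 ℕ.* e) ℕ.+ 1 ∎
  where
  open ≡-Reasoning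
  b = ∑codes {2 ℕ.+ k} beforeTop
  i = ∑codes {2 ℕ.+ k} increasingPairs
  e = 2 ^ suc k
  isolate : ∀ b x → b ℕ.+ (x ℕ.+ 1) ℕ.+ (x ℕ.+ 1) ≡ (b ℕ.+ 1) ℕ.+ (x ℕ.+ x ℕ.+ 1)
  isolate = solve-∀
  collect : ∀ k e → 2 ℕ.* e ℕ.+ (k ℕ.* e ℕ.+ k ℕ.* e ℕ.+ 1) ≡ suc k ℕ.* (2 ℕ.* e) ℕ.+ 1
  collect = solve-∀

∑decreasingPairs : ∀ k → ∑codes {2 ℕ.+ k} decreasingPairs ℕ.+ 1 ≡ (k ℕ.* k ℕ.+ 2 ℕ.* k ℕ.+ 2) ℕ.* 2 ^ suc k
∑decreasingPairs zero    = refl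
∑decreasingPairs (suc k) = begin
  ∑codes {3 ℕ.+ k} decreasingPairs ℕ.+ 1
    ≡⟨ cong (ℕ._+ 1) (trans (∑codes-suc {2 ℕ.+ k} decreasingPairs)
         (cong₂ ℕ._+_ (∑codes-+ (2 ℕ.+ k) afterTop decreasingPairs)
           (trans (∑codes-+ (2 ℕ.+ k) (λ _ → 2 ℕ.+ k) decreasingPairs) (cong (ℕ._+ d) (∑codes-const (2 ℕ.+ k) (2 ℕ.+ k)))))) ⟩
  ∑codes {2 ℕ.+ k} afterTop ℕ.+ d ℕ.+ ((2 ℕ.+ k) ℕ.* (2 ℕ.* e) ℕ.+ d) ℕ.+ 1
    ≡⟨ cong (λ a → a ℕ.+ d ℕ.+ ((2 ℕ.+ k) ℕ.* (2 ℕ.* e) ℕ.+ d) ℕ.+ 1) (∑afterTop (suc k)) ⟩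
  suc k ℕ.* (2 ℕ.* e) ℕ.+ 1 ℕ.+ d ℕ.+ ((2 ℕ.+ k) ℕ.* (2 ℕ.* e) ℕ.+ d) ℕ.+ 1
    -- The 1 from `∑afterTop` and the 1 of the claim complete 2d to 2(d + 1), the form of the
    -- induction hypothesis.
    ≡⟨ isolate k e d ⟩
  2 ℕ.* (d ℕ.+ 1) ℕ.+ (2 ℕ.* k ℕ.+ 3) ℕ.* (2 ℕ.* e)
    ≡⟨ cong (λ d → 2 ℕ.* d ℕ.+ (2 ℕ.* k ℕ.+ 3) ℕ.* (2 ℕ.* e)) (∑decreasingPairs k) ⟩
  2 ℕ.* ((k ℕ.* k ℕ.+ 2 ℕ.* k ℕ.+ 2) ℕ.* e) ℕ.+ (2 ℕ.* k ℕ.+ 3) ℕ.* (2 ℕ.* e)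
    ≡⟨ collect k e ⟩
  (suc k ℕ.* suc k ℕ.+ 2 ℕ.* suc k ℕ.+ 2) ℕ.* (2 ℕ.* e) ∎
  where
  open ≡-Reasoning
  d = ∑codes {2 ℕ.+ k} decreasingPairs
  e = 2 ^ suc k
  isolate : ∀ k e d → suc k ℕ.* (2 ℕ.* e) ℕ.+ 1 ℕ.+ d ℕ.+ ((2 ℕ.+ k) ℕ.* (2 ℕ.* e) ℕ.+ d) ℕ.+ 1 ≡
                      2 ℕ.* (d ℕ.+ 1) ℕ.+ (2 ℕ.* k ℕ.+ 3) ℕ.* (2 ℕ.* e)
  isolate = solve-∀
  collect : ∀ k e → 2 ℕ.* ((k ℕ.* k ℕ.+ 2 ℕ.* k ℕ.+ 2) ℕ.* e) ℕ.+ (2 ℕ.* k ℕ.+ 3) ℕ.* (2 ℕ.* e) ≡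
                    (suc k ℕ.* suc k ℕ.+ 2 ℕ.* suc k ℕ.+ 2) ℕ.* (2 ℕ.* e)
  collect = solve-∀

-- The recurrence is that of `∑increasingPairs` with the two bits exchanged: here the leading `true`
-- adds `beforeTop`.
∑count213 : ∀ k → ∑codes {2 ℕ.+ k} count213 ≡ k ℕ.* 2 ^ suc k ℕ.+ 1
∑count213 zero    = refl
∑count213 (suc k) = begin
  ∑codes {3 ℕ.+ k} count213
    ≡⟨ trans (∑codes-suc {2 ℕ.+ k} count213) (cong (s ℕ.+_) (∑codes-+ (2 ℕ.+ k) beforeTop count213)) ⟩
  s ℕ.+ (b ℕ.+ s)
    ≡⟨ cong (λ s → s ℕ.+ (b ℕ.+ s)) (∑count213 k) ⟩
  k ℕ.* e ℕ.+ 1 ℕ.+ (b ℕ.+ (k ℕ.* e ℕ.+ 1))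
    ≡⟨ isolate b (k ℕ.* e) ⟩
  (b ℕ.+ 1) ℕ.+ (k ℕ.* e ℕ.+ k ℕ.* e ℕ.+ 1)
    ≡⟨ cong (ℕ._+ (k ℕ.* e ℕ.+ k ℕ.* e ℕ.+ 1)) (∑beforeTop (2 ℕ.+ k)) ⟩
  2 ℕ.* e ℕ.+ (k ℕ.* e ℕ.+ k ℕ.* e ℕ.+ 1)
    ≡⟨ collect k e ⟩
  suc k ℕ.* (2 ℕ.* e) ℕ.+ 1 ∎
  where
  open ≡-Reasoning
  b = ∑codes {2 ℕ.+ k} beforeTop
  s = ∑codes {2 ℕ.+ k} count213
  e = 2 ^ suc k
  isolate : ∀ b x → x ℕ.+ 1 ℕ.+ (b ℕ.+ (x ℕ.+ 1)) ≡ (b ℕ.+ 1) ℕ.+ (x ℕ.+ x ℕ.+ 1)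
  isolate = solve-∀
  collect : ∀ k e → 2 ℕ.* e ℕ.+ (k ℕ.* e ℕ.+ k ℕ.* e ℕ.+ 1) ≡ suc k ℕ.* (2 ℕ.* e) ℕ.+ 1
  collect = solve-∀

-- The sum doubles and grows by that of `afterTop`. The factor k² + k + 2 is n² - 5n + 8 at n = k +
-- 3.
∑count231 : ∀ k → ∑codes {2 ℕ.+ k} count231 ℕ.+ 1 ≡ (k ℕ.* k ℕ.+ k ℕ.+ 2) ℕ.* 2 ^ k
∑count231 zero    = refl
∑count231 (suc k) = begin
  ∑codes {3 ℕ.+ k} count231 ℕ.+ 1
    ≡⟨ cong (ℕ._+ 1) (trans (∑codes-suc {2 ℕ.+ k} count231) (cong (s ℕ.+_) (∑codes-+ (2 ℕ.+ k) afterTop count231))) ⟩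
  s ℕ.+ (∑codes {2 ℕ.+ k} afterTop ℕ.+ s) ℕ.+ 1
    ≡⟨ cong (λ a → s ℕ.+ (a ℕ.+ s) ℕ.+ 1) (∑afterTop (suc k)) ⟩
  s ℕ.+ (suc k ℕ.* (2 ℕ.* (2 ℕ.* e)) ℕ.+ 1 ℕ.+ s) ℕ.+ 1
    ≡⟨ isolate s k e ⟩
  2 ℕ.* (s ℕ.+ 1) ℕ.+ suc k ℕ.* (2 ℕ.* (2 ℕ.* e))
    ≡⟨ cong (λ s → 2 ℕ.* s ℕ.+ suc k ℕ.* (2 ℕ.* (2 ℕ.* e))) (∑count231 k) ⟩
  2 ℕ.* ((k ℕ.* k ℕ.+ k ℕ.+ 2) ℕ.* e) ℕ.+ suc k ℕ.* (2 ℕ.* (2 ℕ.* e))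
    ≡⟨ collect k e ⟩
  (suc k ℕ.* suc k ℕ.+ suc k ℕ.+ 2) ℕ.* (2 ℕ.* e) ∎
  where
  open ≡-Reasoning
  s = ∑codes {2 ℕ.+ k} count231
  e = 2 ^ k
  isolate : ∀ s k e → s ℕ.+ (suc k ℕ.* (2 ℕ.* (2 ℕ.* e)) ℕ.+ 1 ℕ.+ s) ℕ.+ 1 ≡
                      2 ℕ.* (s ℕ.+ 1) ℕ.+ suc k ℕ.* (2 ℕ.* (2 ℕ.* e))
  isolate = solve-∀
  collect : ∀ k e → 2 ℕ.* ((k ℕ.* k ℕ.+ k ℕ.+ 2) ℕ.* e) ℕ.+ suc k ℕ.* (2 ℕ.* (2 ℕ.* e)) ≡
                    (suc k ℕ.* suc k ℕ.+ suc k ℕ.+ 2) ℕ.* (2 ℕ.* e)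
  collect = solve-∀

-- The sum doubles and grows by those of `beforeTop` and of `increasingPairs` taken twice. This
-- increment equals the sum of `afterTop`, namely (k + 1) 2^(k + 2) + 1, hence the same closed form
-- as for 231.
∑count312 : ∀ k → ∑codes {2 ℕ.+ k} count312 ℕ.+ 1 ≡ (k ℕ.* k ℕ.+ k ℕ.+ 2) ℕ.* 2 ^ k
∑count312 zero    = refl
∑count312 (suc k) = begin
  ∑codes {3 ℕ.+ k} count312 ℕ.+ 1
    ≡⟨ cong (ℕ._+ 1) (trans (∑codes-suc {2 ℕ.+ k} count312) (cong₂ ℕ._+_
         (trans (∑codes-+ (2 ℕ.+ k) (λ w → beforeTop w ℕ.+ increasingPairs w) count312)
           (cong (ℕ._+ s) (∑codes-+ (2 ℕ.+ k) beforeTop increasingPairs)))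
         (∑codes-+ (2 ℕ.+ k) increasingPairs count312))) ⟩
  b ℕ.+ i ℕ.+ s ℕ.+ (i ℕ.+ s) ℕ.+ 1
    ≡⟨ cong (λ i → b ℕ.+ i ℕ.+ s ℕ.+ (i ℕ.+ s) ℕ.+ 1) (∑increasingPairs k) ⟩
  b ℕ.+ (k ℕ.* (2 ℕ.* e) ℕ.+ 1) ℕ.+ s ℕ.+ (k ℕ.* (2 ℕ.* e) ℕ.+ 1 ℕ.+ s) ℕ.+ 1
    ≡⟨ isolate b s (k ℕ.* (2 ℕ.* e)) ⟩
  (b ℕ.+ 1) ℕ.+ 2 ℕ.* (s ℕ.+ 1) ℕ.+ 2 ℕ.* (k ℕ.* (2 ℕ.* e))
    ≡⟨ cong₂ (λ b s → b ℕ.+ 2 ℕ.* s ℕ.+ 2 ℕ.* (k ℕ.* (2 ℕ.* e))) (∑beforeTop (2 ℕ.+ k)) (∑count312 k) ⟩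
  2 ℕ.* (2 ℕ.* e) ℕ.+ 2 ℕ.* ((k ℕ.* k ℕ.+ k ℕ.+ 2) ℕ.* e) ℕ.+ 2 ℕ.* (k ℕ.* (2 ℕ.* e))
    ≡⟨ collect k e ⟩
  (suc k ℕ.* suc k ℕ.+ suc k ℕ.+ 2) ℕ.* (2 ℕ.* e) ∎
  where
  open ≡-Reasoning
  b = ∑codes {2 ℕ.+ k} beforeTop
  i = ∑codes {2 ℕ.+ k} increasingPairs
  s = ∑codes {2 ℕ.+ k} count312
  e = 2 ^ k
  isolate : ∀ b s x → b ℕ.+ (x ℕ.+ 1) ℕ.+ s ℕ.+ (x ℕ.+ 1 ℕ.+ s) ℕ.+ 1 ≡ (b ℕ.+ 1) ℕ.+ 2 ℕ.* (s ℕ.+ 1) ℕ.+ 2 ℕ.* x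
  isolate = solve-∀
  collect : ∀ k e → 2 ℕ.* (2 ℕ.* e) ℕ.+ 2 ℕ.* ((k ℕ.* k ℕ.+ k ℕ.+ 2) ℕ.* e) ℕ.+ 2 ℕ.* (k ℕ.* (2 ℕ.* e)) ≡
                    (suc k ℕ.* suc k ℕ.+ suc k ℕ.+ 2) ℕ.* (2 ℕ.* e)
  collect = solve-∀

-- The cubic is three times n³/3 - 2n² + 14n/3 - 5 at n = k + 3, where its constant term vanishes;
-- the final 3 is three times the summand 1.
∑count321 : ∀ k → 3 ℕ.* ∑codes {2 ℕ.+ k} count321 ≡
                  (k ℕ.* k ℕ.* k ℕ.+ 3 ℕ.* (k ℕ.* k) ℕ.+ 5 ℕ.* k) ℕ.* 2 ^ suc k ℕ.+ 3
∑count321 zero    = refl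
∑count321 (suc k) = begin
  3 ℕ.* ∑codes {3 ℕ.+ k} count321
    ≡⟨ cong (3 ℕ.*_) (trans (∑codes-suc {2 ℕ.+ k} count321) (cong₂ ℕ._+_
         (trans (∑codes-+ (2 ℕ.+ k) (λ w → afterTop w ℕ.+ decreasingPairs w) count321)
           (cong (ℕ._+ s) (∑codes-+ (2 ℕ.+ k) afterTop decreasingPairs)))
         (∑codes-+ (2 ℕ.+ k) decreasingPairs count321))) ⟩
  3 ℕ.* (∑codes {2 ℕ.+ k} afterTop ℕ.+ d ℕ.+ s ℕ.+ (d ℕ.+ s))
    ≡⟨ regroup (∑codes {2 ℕ.+ k} afterTop) d s ⟩
  3 ℕ.* ∑codes {2 ℕ.+ k} afterTop ℕ.+ 6 ℕ.* d ℕ.+ 2 ℕ.* (3 ℕ.* s)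
    ≡⟨ cong₂ (λ a s → 3 ℕ.* a ℕ.+ 6 ℕ.* d ℕ.+ 2 ℕ.* s) (∑afterTop (suc k)) (∑count321 k) ⟩
  3 ℕ.* (suc k ℕ.* (2 ℕ.* e) ℕ.+ 1) ℕ.+ 6 ℕ.* d ℕ.+ 2 ℕ.* (x ℕ.+ 3)
    ≡⟨ isolate (suc k ℕ.* (2 ℕ.* e)) d x ⟩
  3 ℕ.* (suc k ℕ.* (2 ℕ.* e)) ℕ.+ 6 ℕ.* (d ℕ.+ 1) ℕ.+ 2 ℕ.* x ℕ.+ 3
    ≡⟨ cong (λ d → 3 ℕ.* (suc k ℕ.* (2 ℕ.* e)) ℕ.+ 6 ℕ.* d ℕ.+ 2 ℕ.* x ℕ.+ 3) (∑decreasingPairs k) ⟩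
  3 ℕ.* (suc k ℕ.* (2 ℕ.* e)) ℕ.+ 6 ℕ.* ((k ℕ.* k ℕ.+ 2 ℕ.* k ℕ.+ 2) ℕ.* e) ℕ.+ 2 ℕ.* x ℕ.+ 3
    ≡⟨ collect k e ⟩
  (suc k ℕ.* suc k ℕ.* suc k ℕ.+ 3 ℕ.* (suc k ℕ.* suc k) ℕ.+ 5 ℕ.* suc k) ℕ.* (2 ℕ.* e) ℕ.+ 3 ∎
  where
  open ≡-Reasoning
  d = ∑codes {2 ℕ.+ k} decreasingPairs
  s = ∑codes {2 ℕ.+ k} count321
  e = 2 ^ suc k
  x = (k ℕ.* k ℕ.* k ℕ.+ 3 ℕ.* (k ℕ.* k) ℕ.+ 5 ℕ.* k) ℕ.* e
  regroup : ∀ a d s → 3 ℕ.* (a ℕ.+ d ℕ.+ s ℕ.+ (d ℕ.+ s)) ≡ 3 ℕ.* a ℕ.+ 6 ℕ.* d ℕ.+ 2 ℕ.* (3 ℕ.* s)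
  regroup = solve-∀
  isolate : ∀ a d x → 3 ℕ.* (a ℕ.+ 1) ℕ.+ 6 ℕ.* d ℕ.+ 2 ℕ.* (x ℕ.+ 3) ≡ 3 ℕ.* a ℕ.+ 6 ℕ.* (d ℕ.+ 1) ℕ.+ 2 ℕ.* x ℕ.+ 3
  isolate = solve-∀
  collect : ∀ k e →
    3 ℕ.* (suc k ℕ.* (2 ℕ.* e)) ℕ.+ 6 ℕ.* ((k ℕ.* k ℕ.+ 2 ℕ.* k ℕ.+ 2) ℕ.* e) ℕ.+
      2 ℕ.* ((k ℕ.* k ℕ.* k ℕ.+ 3 ℕ.* (k ℕ.* k) ℕ.+ 5 ℕ.* k) ℕ.* e) ℕ.+ 3 ≡
    (suc k ℕ.* suc k ℕ.* suc k ℕ.+ 3 ℕ.* (suc k ℕ.* suc k) ℕ.+ 5 ℕ.* suc k) ℕ.* (2 ℕ.* e) ℕ.+ 3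
  collect = solve-∀

-- Pattern totals as sums over codes

total-count : ∀ q {f : ∀ {m} → Vec Bool m → ℕ} → (∀ {m} (w : Vec Bool m) → occurrences q (decode w) ≡ f w) →
              ∀ m → total q (suc m) ≡ ∑codes {m} f
total-count q occ≡f m = trans (total-decode q m) (cong sum (List.map-cong occ≡f (codes m)))

total213 : ∀ m → total p213 (suc m) ≡ ∑codes {m} count213
total213 = total-count p213 λ w → trans (occurrences-decode p213 w)
  (select (count213 w) (count231 w) (count312 w) (count321 w))
  where
  select : ∀ a b c d → a ℕ.* 1 ℕ.+ b ℕ.* 0 ℕ.+ c ℕ.* 0 ℕ.+ d ℕ.* 0 ≡ a
  select = solve-∀

total231 : ∀ m → total p231 (suc m) ≡ ∑codes {m} count231
total231 = total-count p231 λ w → trans (occurrences-decode p231 w)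
  (select (count213 w) (count231 w) (count312 w) (count321 w))
  where
  select : ∀ a b c d → a ℕ.* 0 ℕ.+ b ℕ.* 1 ℕ.+ c ℕ.* 0 ℕ.+ d ℕ.* 0 ≡ b
  select = solve-∀

total312 : ∀ m → total p312 (suc m) ≡ ∑codes {m} count312
total312 = total-count p312 λ w → trans (occurrences-decode p312 w)
  (select (count213 w) (count231 w) (count312 w) (count321 w))
  where
  select : ∀ a b c d → a ℕ.* 0 ℕ.+ b ℕ.* 0 ℕ.+ c ℕ.* 1 ℕ.+ d ℕ.* 0 ≡ c
  select = solve-∀

total321 : ∀ m → total p321 (suc m) ≡ ∑codes {m} count321
total321 = total-count p321 λ w → trans (occurrences-decode p321 w)
  (select (count213 w) (count231 w) (count312 w) (count321 w))
  where
  select : ∀ a b c d → a ℕ.* 0 ℕ.+ b ℕ.* 0 ℕ.+ c ℕ.* 0 ℕ.+ d ℕ.* 1 ≡ d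
  select = solve-∀

-- Natural numbers inside the rationals

toℚᵘ-toℚ : ∀ m → toℚᵘ (toℚ m) ℚᵘ.≃ ℚᵘ.mkℚᵘ (+ m) 0
toℚᵘ-toℚ m = ℚ.toℚᵘ-fromℚᵘ (ℚᵘ.mkℚᵘ (+ m) 0)

-- Among unnormalised fractions no common factor is cancelled, so the equality is a cross
-- multiplication of integers.
toℚ-+ : ∀ m n → toℚ (m ℕ.+ n) ≡ toℚ m + toℚ n
toℚ-+ m n = ℚ.toℚᵘ-injective (begin
  toℚᵘ (toℚ (m ℕ.+ n))                  ≈⟨ toℚᵘ-toℚ (m ℕ.+ n) ⟩
  ℚᵘ.mkℚᵘ (+ (m ℕ.+ n)) 0                 ≈⟨ ℚᵘ.*≡* (cong (ℤ._* + 1) (sym (cong₂ ℤ._+_ (ℤ.*-identityʳ (+ m)) (ℤ.*-identityʳ (+ n))))) ⟩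
  ℚᵘ.mkℚᵘ (+ m) 0 ℚᵘ.+ ℚᵘ.mkℚᵘ (+ n) 0    ≈⟨ ℚᵘ.+-cong (toℚᵘ-toℚ m) (toℚᵘ-toℚ n) ⟨
  toℚᵘ (toℚ m) ℚᵘ.+ toℚᵘ (toℚ n)      ≈⟨ ℚ.toℚᵘ-homo-+ (toℚ m) (toℚ n) ⟨
  toℚᵘ (toℚ m + toℚ n)                  ∎)
  where open ≈-Reasoning ℚᵘ.≃-setoid

toℚ-* : ∀ m n → toℚ (m ℕ.* n) ≡ toℚ m * toℚ n
toℚ-* m n = ℚ.toℚᵘ-injective (begin
  toℚᵘ (toℚ (m ℕ.* n))                  ≈⟨ toℚᵘ-toℚ (m ℕ.* n) ⟩
  ℚᵘ.mkℚᵘ (+ (m ℕ.* n)) 0                 ≈⟨ ℚᵘ.*≡* (cong (ℤ._* + 1) (ℤ.pos-* m n)) ⟩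
  ℚᵘ.mkℚᵘ (+ m) 0 ℚᵘ.* ℚᵘ.mkℚᵘ (+ n) 0    ≈⟨ ℚᵘ.*-cong (toℚᵘ-toℚ m) (toℚᵘ-toℚ n) ⟨
  toℚᵘ (toℚ m) ℚᵘ.* toℚᵘ (toℚ n)      ≈⟨ ℚ.toℚᵘ-homo-* (toℚ m) (toℚ n) ⟨
  toℚᵘ (toℚ m * toℚ n)                  ∎)
  where open ≈-Reasoning ℚᵘ.≃-setoid

-- Division by 3 becomes multiplication by a constant, which the ring solver accepts as a
-- coefficient.
/3≡*⅓ : ∀ m → + m / 3 ≡ toℚ m * (+ 1 / 3)
/3≡*⅓ m = ℚ.toℚᵘ-injective (begin
  toℚᵘ (+ m / 3)                              ≈⟨ ℚ.toℚᵘ-fromℚᵘ (ℚᵘ.mkℚᵘ (+ m) 2) ⟩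
  ℚᵘ.mkℚᵘ (+ m) 2                               ≈⟨ ℚᵘ.*≡* (cong (ℤ._* + 3) (sym (ℤ.*-identityʳ (+ m)))) ⟩
  ℚᵘ.mkℚᵘ (+ m) 0 ℚᵘ.* ℚᵘ.mkℚᵘ (+ 1) 2          ≈⟨ ℚᵘ.*-congʳ (toℚᵘ-toℚ m) ⟨
  toℚᵘ (toℚ m) ℚᵘ.* toℚᵘ (+ 1 / 3)          ≈⟨ ℚ.toℚᵘ-homo-* (toℚ m) (+ 1 / 3) ⟨
  toℚᵘ (toℚ m * (+ 1 / 3))                    ∎)
  where open ≈-Reasoning ℚᵘ.≃-setoid

toℚ-square : ∀ n → toℚ (n ^ 2) ≡ toℚ n * toℚ n
toℚ-square n = trans (cong (λ m → toℚ (n ℕ.* m)) (ℕ.*-identityʳ n)) (toℚ-* n n)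

toℚ-cube : ∀ n → toℚ (n ^ 3) ≡ toℚ n * (toℚ n * toℚ n)
toℚ-cube n = trans (toℚ-* n (n ^ 2)) (cong (toℚ n *_) (toℚ-square n))

+1-cancel : ∀ {p q} → p + 1ℚ ≡ q → p ≡ q - 1ℚ
+1-cancel {p} refl = solve 1 (λ P → P := P :+ con 1ℚ :- con 1ℚ) refl p
  where open +-*-Solver

-- The closed formulas in n

total213-formula : ∀ k → toℚ (total p213 (3 ℕ.+ k)) ≡ (toℚ (3 ℕ.+ k) - toℚ 3) * toℚ (2 ^ suc k) + 1ℚ
total213-formula k = begin
  toℚ (total p213 (3 ℕ.+ k))
    ≡⟨ cong toℚ (trans (total213 (2 ℕ.+ k)) (∑count213 k)) ⟩
  toℚ (k ℕ.* 2 ^ suc k ℕ.+ 1)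
    ≡⟨ trans (toℚ-+ (k ℕ.* 2 ^ suc k) 1) (cong (_+ 1ℚ) (toℚ-* k (2 ^ suc k))) ⟩
  toℚ k * toℚ (2 ^ suc k) + 1ℚ
    -- With n split as 3 + k and the power of 2 taken as an independent variable, a polynomial
    -- identity remains.
    ≡⟨ solve 2 (λ K E → K :* E :+ con 1ℚ := (con (toℚ 3) :+ K :- con (toℚ 3)) :* E :+ con 1ℚ)
         refl (toℚ k) (toℚ (2 ^ suc k)) ⟩
  (toℚ 3 + toℚ k - toℚ 3) * toℚ (2 ^ suc k) + 1ℚ
    ≡⟨ cong (λ n → (n - toℚ 3) * toℚ (2 ^ suc k) + 1ℚ) (toℚ-+ 3 k) ⟨
  (toℚ (3 ℕ.+ k) - toℚ 3) * toℚ (2 ^ suc k) + 1ℚ ∎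
  where
  open ≡-Reasoning
  open +-*-Solver

total312-formula : ∀ k → toℚ (total p312 (3 ℕ.+ k)) ≡
  (toℚ ((3 ℕ.+ k) ^ 2) - toℚ (5 ℕ.* (3 ℕ.+ k)) + toℚ 8) * toℚ (2 ^ k) - 1ℚ
total312-formula k = +1-cancel (begin
  toℚ (total p312 n) + 1ℚ
    ≡⟨ toℚ-+ (total p312 n) 1 ⟨
  toℚ (total p312 n ℕ.+ 1)
    ≡⟨ cong toℚ (trans (cong (ℕ._+ 1) (total312 (2 ℕ.+ k))) (∑count312 k)) ⟩
  toℚ ((k ℕ.* k ℕ.+ k ℕ.+ 2) ℕ.* 2 ^ k)
    ≡⟨ trans (toℚ-* (k ℕ.* k ℕ.+ k ℕ.+ 2) (2 ^ k)) (cong (_* toℚ (2 ^ k))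
         (trans (toℚ-+ (k ℕ.* k ℕ.+ k) 2) (cong (_+ toℚ 2)
         (trans (toℚ-+ (k ℕ.* k) k) (cong (_+ toℚ k) (toℚ-* k k)))))) ⟩
  (toℚ k * toℚ k + toℚ k + toℚ 2) * toℚ (2 ^ k)
    ≡⟨ solve 2 (λ K E → (K :* K :+ K :+ con (toℚ 2)) :* E :=
         ((con (toℚ 3) :+ K) :* (con (toℚ 3) :+ K) :- con (toℚ 5) :* (con (toℚ 3) :+ K) :+ con (toℚ 8)) :* E)
         refl (toℚ k) (toℚ (2 ^ k)) ⟩
  ((toℚ 3 + toℚ k) * (toℚ 3 + toℚ k) - toℚ 5 * (toℚ 3 + toℚ k) + toℚ 8) * toℚ (2 ^ k)
    ≡⟨ cong (λ x → (x * x - toℚ 5 * x + toℚ 8) * toℚ (2 ^ k)) (toℚ-+ 3 k) ⟨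
  (toℚ n * toℚ n - toℚ 5 * toℚ n + toℚ 8) * toℚ (2 ^ k)
    ≡⟨ cong₂ (λ x y → (x - y + toℚ 8) * toℚ (2 ^ k)) (toℚ-square n) (toℚ-* 5 n) ⟨
  (toℚ (n ^ 2) - toℚ (5 ℕ.* n) + toℚ 8) * toℚ (2 ^ k) ∎)
  where
  open ≡-Reasoning
  open +-*-Solver
  n = 3 ℕ.+ k

total321-formula : ∀ k → let n = 3 ℕ.+ k in toℚ (total p321 n) ≡
  (+ (n ^ 3) / 3 - toℚ (2 ℕ.* n ^ 2) + + (14 ℕ.* n) / 3 - toℚ 5) * toℚ (2 ^ suc k) + 1ℚ
total321-formula k = begin
  toℚ (total p321 n)
    -- The count is known only in tripled form, so it is multiplied by 3 and by 1/3.
    ≡⟨ solve 1 (λ T → T := con (toℚ 3) :* T :* con (+ 1 / 3)) refl (toℚ (total p321 n)) ⟩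
  toℚ 3 * toℚ (total p321 n) * (+ 1 / 3)
    ≡⟨ cong (_* (+ 1 / 3)) triple ⟩
  ((toℚ k * toℚ k * toℚ k + toℚ 3 * (toℚ k * toℚ k) + toℚ 5 * toℚ k) * toℚ (2 ^ suc k) + toℚ 3) * (+ 1 / 3)
    ≡⟨ solve 2 (λ K E → let N = con (toℚ 3) :+ K in
         ((K :* K :* K :+ con (toℚ 3) :* (K :* K) :+ con (toℚ 5) :* K) :* E :+ con (toℚ 3)) :* con (+ 1 / 3) :=
         (N :* (N :* N) :* con (+ 1 / 3) :- con (toℚ 2) :* (N :* N) :+ con (toℚ 14) :* N :* con (+ 1 / 3) :- con (toℚ 5)) :* E :+ con 1ℚ)
         refl (toℚ k) (toℚ (2 ^ suc k)) ⟩
  polynomial (toℚ 3 + toℚ k) * toℚ (2 ^ suc k) + 1ℚ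
    ≡⟨ cong (λ p → p * toℚ (2 ^ suc k) + 1ℚ) (trans coefficient (cong polynomial (toℚ-+ 3 k))) ⟨
  (+ (n ^ 3) / 3 - toℚ (2 ℕ.* n ^ 2) + + (14 ℕ.* n) / 3 - toℚ 5) * toℚ (2 ^ suc k) + 1ℚ ∎
  where
  open ≡-Reasoning
  open +-*-Solver
  n = 3 ℕ.+ k

  polynomial : ℚ → ℚ
  polynomial N = N * (N * N) * (+ 1 / 3) - toℚ 2 * (N * N) + toℚ 14 * N * (+ 1 / 3) - toℚ 5

  coefficient : + (n ^ 3) / 3 - toℚ (2 ℕ.* n ^ 2) + + (14 ℕ.* n) / 3 - toℚ 5 ≡ polynomial (toℚ n)
  coefficient = cong (_- toℚ 5) (cong₂ _+_ (cong₂ _-_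
    (trans (/3≡*⅓ (n ^ 3)) (cong (_* (+ 1 / 3)) (toℚ-cube n)))
    (trans (toℚ-* 2 (n ^ 2)) (cong (toℚ 2 *_) (toℚ-square n))))
    (trans (/3≡*⅓ (14 ℕ.* n)) (cong (_* (+ 1 / 3)) (toℚ-* 14 n))))

  cubic : ℕ
  cubic = k ℕ.* k ℕ.* k ℕ.+ 3 ℕ.* (k ℕ.* k) ℕ.+ 5 ℕ.* k

  toℚ-cubic : toℚ cubic ≡ toℚ k * toℚ k * toℚ k + toℚ 3 * (toℚ k * toℚ k) + toℚ 5 * toℚ k
  toℚ-cubic = trans (toℚ-+ (k ℕ.* k ℕ.* k ℕ.+ 3 ℕ.* (k ℕ.* k)) (5 ℕ.* k)) (cong₂ _+_
    (trans (toℚ-+ (k ℕ.* k ℕ.* k) (3 ℕ.* (k ℕ.* k))) (cong₂ _+_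
      (trans (toℚ-* (k ℕ.* k) k) (cong (_* toℚ k) (toℚ-* k k)))
      (trans (toℚ-* 3 (k ℕ.* k)) (cong (toℚ 3 *_) (toℚ-* k k)))))
    (toℚ-* 5 k))

  triple : toℚ 3 * toℚ (total p321 n) ≡
    (toℚ k * toℚ k * toℚ k + toℚ 3 * (toℚ k * toℚ k) + toℚ 5 * toℚ k) * toℚ (2 ^ suc k) + toℚ 3
  triple = begin
    toℚ 3 * toℚ (total p321 n)
      ≡⟨ toℚ-* 3 (total p321 n) ⟨
    toℚ (3 ℕ.* total p321 n)
      ≡⟨ cong toℚ (trans (cong (3 ℕ.*_) (total321 (2 ℕ.+ k))) (∑count321 k)) ⟩
    toℚ (cubic ℕ.* 2 ^ suc k ℕ.+ 3)
      ≡⟨ trans (toℚ-+ (cubic ℕ.* 2 ^ suc k) 3) (cong (_+ toℚ 3) (toℚ-* cubic (2 ^ suc k))) ⟩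
    toℚ cubic * toℚ (2 ^ suc k) + toℚ 3
      ≡⟨ cong (λ c → c * toℚ (2 ^ suc k) + toℚ 3) toℚ-cubic ⟩
    (toℚ k * toℚ k * toℚ k + toℚ 3 * (toℚ k * toℚ k) + toℚ 5 * toℚ k) * toℚ (2 ^ suc k) + toℚ 3 ∎

-- Inversion of permutations fixes 123 and 132 and exchanges 231 and 312, which explains the
-- equality; here it is read off from the common closed form.
total231≡total312 : ∀ k → total p231 (3 ℕ.+ k) ≡ total p312 (3 ℕ.+ k)
total231≡total312 k = trans (total231 (2 ℕ.+ k)) (trans
  (ℕ.+-cancelʳ-≡ 1 _ _ (trans (∑count231 k) (sym (∑count312 k)))) (sym (total312 (2 ℕ.+ k))))

theorem2p7 : (n : ℕ) → n ≥ 3 →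
    (toℚ (total p213 n) ≡ (toℚ n - toℚ 3) * toℚ (2 ^ (n ∸ 2)) + 1ℚ)
    × (total p231 n ≡ total p312 n)
    × (toℚ (total p312 n) ≡ (toℚ (n ^ 2) - toℚ (5 ℕ.* n) + toℚ 8) * toℚ (2 ^ (n ∸ 3)) - 1ℚ)
    × (toℚ (total p321 n) ≡ ((+ (n ^ 3)) / 3 - toℚ (2 ℕ.* n ^ 2) + (+ (14 ℕ.* n)) / 3 - toℚ 5) * toℚ (2 ^ (n ∸ 2)) + 1ℚ)
-- Matching on the bound replaces n by 3 + k, so that `n ∸ 2` and `n ∸ 3` compute to `suc k` and
-- `k`.
theorem2p7 _ (ℕ.s≤s (ℕ.s≤s (ℕ.s≤s (ℕ.z≤n {k})))) =
  total213-formula k , total231≡total312 k , total312-formula k , total321-formula k
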